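{- Let $A$ be a finite alphabet. The antipode $S$ of the Hopf algebra of sentences over $A$ is given, for every sentence $I$, by $$S(I)=\sum_{J\preccurlyeq I^r}(-1)^{\ell(J)}J .$$
   Context: $\Bbbk$ is a field of characteristic zero. A word is a finite sequence of letters of $A$. A sentence $I=(w_1,\dots,w_m)$ is a finite sequence of non-empty words; the empty sentence is denoted by $1$. Its length is $\ell(I)=m$. Its reversal is $I^r=(w_m,w_{m-1},\dots,w_1)$ (the words themselves are not reversed). For sentences $I,J$, write $J\preccurlyeq I$ ($J$ is a refinement of $I$) if the words of $I$ can be obtained by concatenating adjacent words of $J$. The Hopf algebra of sentences is the $\Bbbk$-vector space with basis the sentences over $A$, with multiplication the concatenation $(w_1,\dots,w_m)\cdot(v_1,\dots,v_n)=(w_1,\dots,w_m,v_1,\dots,v_n)$, unit the empty sentence, counit $\epsilon(1)=1$ and $\epsilon(I)=0$ for $I\neq 1$, and comultiplication $\Delta(I)=\sum_{J\subset I}\widetilde{I\setminus J}\otimes\widetilde J$. Here $J=(v_1,\dots,v_m)\subset I=(w_1,\dots,w_m)$ runs over sequences of possibly empty words such that $w_i=u_iv_i$ for some words $u_i$; $I\setminus J=(u_1,\dots,u_m)$; and tilde means deleting the empty words. It is a bialgebra graded by $|I|$ (the total number of letters) and connected, hence a Hopf algebra. -}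

module Defs where

open import Algebra.Apartness.Bundles using (HeytingCommutativeRing; HeytingField)
open import Algebra.Bundles using (CommutativeRing)
import Algebra.Definitions.RawMonoid as RawMonoidDefinitions
open import Algebra.Module.Bundles using (LeftModule)
import Algebra.Module.Construct.TensorUnit as TensorUnit
import Algebra.Module.Morphism.Structures as ModuleMorphisms
import Algebra.Properties.Ring as RingProperties
import Algebra.Properties.Semiring.Exp as SemiringExp
open import Data.Bool.Base using (Bool; true; false; if_then_else_)
open import Data.Fin.Base using (Fin)
open import Data.Fin.Properties using (inj⇒≟)
open import Data.List.Base using (List; []; _∷_; _++_; map; concat; cartesianProductWith; foldr; length; mapMaybe; reverse; [_])
open import Data.List.Membership.Propositional using (_∈_)
open import Data.List.Membership.Propositional.Properties using (∈-map⁺; ∈-map⁻; ∈-++⁺ˡ; ∈-++⁺ʳ; ∈-++⁻; ∈-cartesianProductWith⁺; ∈-cartesianProductWith⁻)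
open import Data.List.NonEmpty.Base as List⁺ using (List⁺; _∷_; _∷⁺_; toList; fromList)
import Data.List.Properties as List
open import Data.List.Relation.Unary.All as All using (All; []; _∷_)
open import Data.List.Relation.Unary.All.Properties as AllP using ()
open import Data.List.Relation.Unary.AllPairs using ([]; _∷_)
open import Data.List.Relation.Unary.Any using (here; there)
open import Data.List.Relation.Unary.Unique.Propositional using (Unique)
import Data.List.Relation.Unary.Unique.Propositional.Properties as Unique
open import Data.Nat.Base using (ℕ; suc)
open import Data.Product.Base using (∃; _×_; _,_; proj₁; proj₂; map₁; uncurry)
open import Data.Product.Properties using () renaming (≡-dec to ×-≡-dec)
open import Data.Sum.Base using (inj₁; inj₂)
open import Function.Base using (id; _∘_)
open import Function.Bundles using (_↔_; _⇔_; mk⇔)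
open import Function.Properties.Inverse using (↔⇒↣)
open import Level using (_⊔_)
open import Relation.Binary.Definitions using (DecidableEquality)
open import Relation.Binary.PropositionalEquality as ≡ using (_≡_; _≢_; refl; cong; cong₂)
import Relation.Binary.Reasoning.Setoid as SetoidReasoning
open import Relation.Nullary using (¬_; does; contradiction)
open import Relation.Nullary.Decidable using (map′)
open import Relation.Unary using (Pred)

Finite : ∀ {a} → Set a → Set a
Finite A = ∃ λ (n : ℕ) → A ↔ Fin n

CharacteristicZero : ∀ {c ℓ₁ ℓ₂} → HeytingField c ℓ₁ ℓ₂ → Set ℓ₁
CharacteristicZero 𝕜 = ∀ n → ¬ (suc n · 1# ≈ 0#)
  where
  open HeytingField 𝕜 using (_≈_; 0#; 1#; heytingCommutativeRing)
  open CommutativeRing (HeytingCommutativeRing.commutativeRing heytingCommutativeRing) using (+-rawMonoid)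
  open RawMonoidDefinitions +-rawMonoid using () renaming (_×_ to _·_)

-- A finite subset of B, given by a repetition-free list of its elements: what
-- is needed to sum over it.
record Enumeration {b p} {B : Set b} (P : Pred B p) : Set (b ⊔ p) where
  field
    elements : List B
    unique   : Unique elements
    ∈⇔       : ∀ {x} → x ∈ elements ⇔ P x

-- The vector space with basis B. Vectors are formal linear combinations,
-- identified when all their coefficients agree.
module FreeModule {c ℓ₁ ℓ₂} (𝕜 : HeytingField c ℓ₁ ℓ₂) {b} {B : Set b} (_≟_ : DecidableEquality B) where

  𝕜-commutativeRing : CommutativeRing c ℓ₁
  𝕜-commutativeRing = HeytingCommutativeRing.commutativeRing (HeytingField.heytingCommutativeRing 𝕜)

  private
    module K = CommutativeRing 𝕜-commutativeRing
    module KP = RingProperties K.ring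
    open K using (Carrier; _+_; _*_; -_; 0#; 1#)

  Vect : Set (c ⊔ b)
  Vect = List (Carrier × B)

  coeff : Vect → B → Carrier
  coeff []            b = 0#
  coeff ((k , b′) ∷ x) b = (if does (b′ ≟ b) then k else 0#) + coeff x b

  infix  4 _≈ᵥ_
  infixl 6 _+ᵥ_
  infixr 7 _•_
  infix  8 -ᵥ_

  -- A record rather than a synonym, so that x and y can be inferred.
  record _≈ᵥ_ (x y : Vect) : Set (b ⊔ ℓ₁) where
    constructor coeffs≈
    field coeff≈ : ∀ b → coeff x b K.≈ coeff y b
  open _≈ᵥ_ public

  0ᵥ : Vect
  0ᵥ = []

  _+ᵥ_ : Vect → Vect → Vect
  _+ᵥ_ = _++_

  _•_ : Carrier → Vect → Vect
  k • x = map (map₁ (k *_)) x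

  -ᵥ_ : Vect → Vect
  -ᵥ x = map (map₁ -_) x

  basis : B → Vect
  basis b = [ 1# , b ]

  ∑ : ∀ {i p} {I : Set i} {P : Pred I p} → Enumeration P → (I → Vect) → Vect
  ∑ E f = foldr _+ᵥ_ 0ᵥ (map f (Enumeration.elements E))

  infix 5 ∑
  syntax ∑ E (λ i → v) = ∑[ i ∈ E ] v

  coeff-+ : ∀ x y b → coeff (x +ᵥ y) b K.≈ coeff x b + coeff y b
  coeff-+ []            y b = K.sym (K.+-identityˡ _)
  coeff-+ ((k , b′) ∷ x) y b = K.trans (K.+-congˡ (coeff-+ x y b)) (K.sym (K.+-assoc _ _ _))

  private
    if-* : ∀ k l (p : Bool) → (if p then k * l else 0#) K.≈ k * (if p then l else 0#)
    if-* k l true  = K.refl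
    if-* k l false = K.sym (K.zeroʳ k)

    if-neg : ∀ l (p : Bool) → (if p then - l else 0#) K.≈ - (if p then l else 0#)
    if-neg l true  = K.refl
    if-neg l false = K.sym KP.-0#≈0#

  coeff-• : ∀ k x b → coeff (k • x) b K.≈ k * coeff x b
  coeff-• k []            b = K.sym (K.zeroʳ k)
  coeff-• k ((l , b′) ∷ x) b =
    K.trans (K.+-cong (if-* k l (does (b′ ≟ b))) (coeff-• k x b)) (K.sym (K.distribˡ k _ _))

  coeff-neg : ∀ x b → coeff (-ᵥ x) b K.≈ - coeff x b
  coeff-neg []            b = K.sym KP.-0#≈0#
  coeff-neg ((l , b′) ∷ x) b =
    K.trans (K.+-cong (if-neg l (does (b′ ≟ b))) (coeff-neg x b)) (KP.-‿+-comm _ _)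

  leftModule : LeftModule K.ring (c ⊔ b) (b ⊔ ℓ₁)
  leftModule = record
    { Carrierᴹ = Vect
    ; _≈ᴹ_ = _≈ᵥ_
    ; _+ᴹ_ = _+ᵥ_
    ; _*ₗ_ = _•_
    ; 0ᴹ = 0ᵥ
    ; -ᴹ_ = -ᵥ_
    ; isLeftModule = record
      { isLeftSemimodule = record
        { +ᴹ-isCommutativeMonoid = record
          { isMonoid = record
            { isSemigroup = record
              { isMagma = record
                { isEquivalence = record
                  { refl  = coeffs≈ λ b → K.refl
                  ; sym   = λ p → coeffs≈ λ b → K.sym (coeff≈ p b)
                  ; trans = λ p q → coeffs≈ λ b → K.trans (coeff≈ p b) (coeff≈ q b)
                  }
                ; ∙-cong = +-cong
                }
              ; assoc = λ x y z → reflexive (List.++-assoc x y z)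
              }
            ; identity = (λ x → reflexive refl) , (λ x → reflexive (List.++-identityʳ x))
            }
          ; comm = λ x y → coeffs≈ λ b →
              K.trans (coeff-+ x y b) (K.trans (K.+-comm _ _) (K.sym (coeff-+ y x b)))
          }
        ; isPreleftSemimodule = record
          { *ₗ-cong = λ {k} {l} {x} {y} k≈l x≈y → coeffs≈ λ b →
              K.trans (coeff-• k x b) (K.trans (K.*-cong k≈l (coeff≈ x≈y b)) (K.sym (coeff-• l y b)))
          ; *ₗ-zeroˡ = λ x → coeffs≈ λ b → K.trans (coeff-• 0# x b) (K.zeroˡ _)
          ; *ₗ-distribʳ = λ x k l → coeffs≈ λ b → begin
              coeff ((k + l) • x) b               ≈⟨ coeff-• (k + l) x b ⟩
              (k + l) * coeff x b                 ≈⟨ K.distribʳ _ k l ⟩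
              k * coeff x b + l * coeff x b       ≈⟨ K.+-cong (coeff-• k x b) (coeff-• l x b) ⟨
              coeff (k • x) b + coeff (l • x) b   ≈⟨ coeff-+ (k • x) (l • x) b ⟨
              coeff (k • x +ᵥ l • x) b            ∎
          ; *ₗ-identityˡ = λ x → coeffs≈ λ b → K.trans (coeff-• 1# x b) (K.*-identityˡ _)
          ; *ₗ-assoc = λ k l x → coeffs≈ λ b → begin
              coeff ((k * l) • x) b   ≈⟨ coeff-• (k * l) x b ⟩
              k * l * coeff x b       ≈⟨ K.*-assoc k l _ ⟩
              k * (l * coeff x b)     ≈⟨ K.*-congˡ (coeff-• l x b) ⟨
              k * coeff (l • x) b     ≈⟨ coeff-• k (l • x) b ⟨
              coeff (k • l • x) b     ∎
          ; *ₗ-zeroʳ = λ k → reflexive refl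
          ; *ₗ-distribˡ = λ k x y → reflexive (List.map-++ (map₁ (k *_)) x y)
          }
        }
      ; -ᴹ‿cong = λ {x} {y} x≈y → coeffs≈ λ b →
          K.trans (coeff-neg x b) (K.trans (K.-‿cong (coeff≈ x≈y b)) (K.sym (coeff-neg y b)))
      ; -ᴹ‿inverse =
          (λ x → coeffs≈ λ b → K.trans (coeff-+ (-ᵥ x) x b) (K.trans (K.+-congʳ (coeff-neg x b)) (K.-‿inverseˡ _)))
        , (λ x → coeffs≈ λ b → K.trans (coeff-+ x (-ᵥ x) b) (K.trans (K.+-congˡ (coeff-neg x b)) (K.-‿inverseʳ _)))
      }
    }
    where
    open SetoidReasoning K.setoid

    reflexive : ∀ {x y} → x ≡ y → x ≈ᵥ y
    reflexive refl = coeffs≈ λ b → K.refl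

    +-cong : ∀ {x y u v} → x ≈ᵥ y → u ≈ᵥ v → x +ᵥ u ≈ᵥ y +ᵥ v
    +-cong {x} {y} {u} {v} p q = coeffs≈ λ b →
      K.trans (coeff-+ x u b) (K.trans (K.+-cong (coeff≈ p b) (coeff≈ q b)) (K.sym (coeff-+ y v b)))

  extend : ∀ {m ℓm} (M : LeftModule K.ring m ℓm) → (B → LeftModule.Carrierᴹ M) → Vect → LeftModule.Carrierᴹ M
  extend M f = foldr (λ (k , b) x → k *ₗ f b +ᴹ x) 0ᴹ
    where open LeftModule M

module Words {a} (A : Set a) where

  Word : Set a
  Word = List A

  Sentence : Set a
  Sentence = List (List⁺ A)

  infix 8 _ʳ
  _ʳ : Sentence → Sentence
  I ʳ = reverse I

  tilde : List Word → Sentence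
  tilde = mapMaybe fromList

  -- A sequence ps = ((u₁ , v₁) , … , (uₘ , vₘ)) with wᵢ = uᵢvᵢ. As vᵢ determines
  -- uᵢ, such a ps is the same as J = (v₁ , … , vₘ) ⊂ I together with I∖J = (u₁ , … , uₘ).
  IsSplitting : Sentence → Pred (List (Word × Word)) a
  IsSplitting I ps = map (uncurry _++_) ps ≡ map toList I

  -- gs groups the words of J into consecutive non-empty blocks, and the words
  -- of I are the concatenations of the blocks.
  infix 4 _≼_
  _≼_ : Sentence → Sentence → Set a
  J ≼ I = ∃ λ (gs : List (List⁺ (List⁺ A))) → concat (map toList gs) ≡ J × map List⁺.concat gs ≡ I

  wordSplittings : Word → List (Word × Word)
  wordSplittings []      = [ [] , [] ]
  wordSplittings (a ∷ w) = ([] , a ∷ w) ∷ map (map₁ (a ∷_)) (wordSplittings w)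

  wordSplittings-unique : ∀ w → Unique (wordSplittings w)
  wordSplittings-unique []      = [] ∷ []
  wordSplittings-unique (a ∷ w) =
    AllP.map⁺ (All.universal (λ _ ()) _) ∷ Unique.map⁺ (λ { refl → refl }) (wordSplittings-unique w)

  wordSplittings-complete : ∀ u v → (u , v) ∈ wordSplittings (u ++ v)
  wordSplittings-complete []      []      = here refl
  wordSplittings-complete []      (b ∷ v) = here refl
  wordSplittings-complete (a ∷ u) v       = there (∈-map⁺ _ (wordSplittings-complete u v))

  wordSplittings-sound : ∀ w {p} → p ∈ wordSplittings w → uncurry _++_ p ≡ w
  wordSplittings-sound []      (here refl) = refl
  wordSplittings-sound (a ∷ w) (here refl) = refl
  wordSplittings-sound (a ∷ w) (there p∈) with q , q∈ , refl ← ∈-map⁻ _ p∈ =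
    cong (a ∷_) (wordSplittings-sound w q∈)

  allSplittings : Sentence → List (List (Word × Word))
  allSplittings []      = [ [] ]
  allSplittings (w ∷ I) = cartesianProductWith _∷_ (wordSplittings (toList w)) (allSplittings I)

  allSplittings-unique : ∀ I → Unique (allSplittings I)
  allSplittings-unique []      = [] ∷ []
  allSplittings-unique (w ∷ I) = Unique.cartesianProductWith⁺ _∷_ List.∷-injective
    (wordSplittings-unique (toList w)) (allSplittings-unique I)

  allSplittings-complete : ∀ I {ps} → IsSplitting I ps → ps ∈ allSplittings I
  allSplittings-complete []      {[]}           _  = here refl
  allSplittings-complete (w ∷ I) {(u , v) ∷ ps} eq = ∈-cartesianProductWith⁺ _∷_
    (≡.subst ((u , v) ∈_) (cong wordSplittings (List.∷-injectiveˡ eq)) (wordSplittings-complete u v))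
    (allSplittings-complete I (List.∷-injectiveʳ eq))

  allSplittings-sound : ∀ I {ps} → ps ∈ allSplittings I → IsSplitting I ps
  allSplittings-sound []      (here refl) = refl
  allSplittings-sound (w ∷ I) ps∈
    with p , qs , p∈ , qs∈ , refl ← ∈-cartesianProductWith⁻ _∷_ (wordSplittings (toList w)) (allSplittings I) ps∈ =
    cong₂ _∷_ (wordSplittings-sound (toList w) p∈) (allSplittings-sound I qs∈)

  splittings : ∀ I → Enumeration (IsSplitting I)
  splittings I = record
    { elements = allSplittings I
    ; unique   = allSplittings-unique I
    ; ∈⇔       = mk⇔ (allSplittings-sound I) (allSplittings-complete I)
    }

  Block : Set a
  Block = List⁺ (List⁺ A)

  cut glue : A → Block → Block
  cut  a g        = (a ∷ []) ∷⁺ g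
  glue a (v ∷ vs) = (a ∷⁺ v) ∷ vs

  glue-injective : ∀ {a g h} → glue a g ≡ glue a h → g ≡ h
  glue-injective {g = (_ ∷ _) ∷ _} {(_ ∷ _) ∷ _} refl = refl

  cut-injective : ∀ {a g h} → cut a g ≡ cut a h → g ≡ h
  cut-injective {g = _ ∷ _} {_ ∷ _} refl = refl

  cut≢glue : ∀ {a g h} → cut a g ≢ glue a h
  cut≢glue {g = _ ∷ _} {(_ ∷ _) ∷ _} ()

  blocks : A → Word → List Block
  blocks a []      = [ (a ∷ []) ∷ [] ]
  blocks a (b ∷ w) = map (cut a) (blocks b w) ++ map (glue a) (blocks b w)

  blocks-unique : ∀ a w → Unique (blocks a w)
  blocks-unique a []      = [] ∷ []
  blocks-unique a (b ∷ w) = Unique.++⁺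
    (Unique.map⁺ cut-injective (blocks-unique b w))
    (Unique.map⁺ glue-injective (blocks-unique b w))
    λ (x∈ , y∈) → let (_ , _ , p) = ∈-map⁻ (cut a) x∈ ; (_ , _ , q) = ∈-map⁻ (glue a) y∈ in
      cut≢glue (≡.trans (≡.sym p) q)

  concat-cut : ∀ a g → List⁺.concat (cut a g) ≡ a ∷⁺ List⁺.concat g
  concat-cut a ((_ ∷ _) ∷ _) = refl

  concat-glue : ∀ a g → List⁺.concat (glue a g) ≡ a ∷⁺ List⁺.concat g
  concat-glue a ((_ ∷ _) ∷ _) = refl

  blocks-sound : ∀ a w {g} → g ∈ blocks a w → List⁺.concat g ≡ a ∷ w
  blocks-sound a []      (here refl) = refl
  blocks-sound a (b ∷ w) g∈ with ∈-++⁻ (map (cut a) (blocks b w)) g∈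
  ... | inj₁ p with h , h∈ , refl ← ∈-map⁻ (cut a) p =
    ≡.trans (concat-cut a h) (cong (a ∷⁺_) (blocks-sound b w h∈))
  ... | inj₂ p with h , h∈ , refl ← ∈-map⁻ (glue a) p =
    ≡.trans (concat-glue a h) (cong (a ∷⁺_) (blocks-sound b w h∈))

  blocks-complete : ∀ a w g → toList (List⁺.concat g) ≡ a ∷ w → g ∈ blocks a w
  blocks-complete a []      ((_ ∷ []) ∷ [])              refl = here refl
  blocks-complete a []      ((_ ∷ []) ∷ (_ ∷ _) ∷ _)     ()
  blocks-complete a (b ∷ w) ((_ ∷ []) ∷ v ∷ vs)          eq with refl ← List.∷-injectiveˡ eq =
    ∈-++⁺ˡ (∈-map⁺ (cut a) (blocks-complete b w (v ∷ vs) (List.∷-injectiveʳ eq)))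
  blocks-complete a (b ∷ w) ((_ ∷ c ∷ v) ∷ vs)           eq with refl ← List.∷-injectiveˡ eq =
    ∈-++⁺ʳ _ (∈-map⁺ (glue a) (blocks-complete b w ((c ∷ v) ∷ vs) (List.∷-injectiveʳ eq)))

  groupings : Sentence → List (List Block)
  groupings []            = [ [] ]
  groupings ((a ∷ w) ∷ I) = cartesianProductWith _∷_ (blocks a w) (groupings I)

  groupings-unique : ∀ I → Unique (groupings I)
  groupings-unique []            = [] ∷ []
  groupings-unique ((a ∷ w) ∷ I) =
    Unique.cartesianProductWith⁺ _∷_ List.∷-injective (blocks-unique a w) (groupings-unique I)

  groupings-sound : ∀ I {gs} → gs ∈ groupings I → map List⁺.concat gs ≡ I
  groupings-sound []            (here refl) = refl
  groupings-sound ((a ∷ w) ∷ I) gs∈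
    with g , hs , g∈ , hs∈ , refl ← ∈-cartesianProductWith⁻ _∷_ (blocks a w) (groupings I) gs∈ =
    cong₂ _∷_ (blocks-sound a w g∈) (groupings-sound I hs∈)

  groupings-complete : ∀ I gs → map List⁺.concat gs ≡ I → gs ∈ groupings I
  groupings-complete []            []       _  = here refl
  groupings-complete ((a ∷ w) ∷ I) (g ∷ gs) eq = ∈-cartesianProductWith⁺ _∷_
    (blocks-complete a w g (cong toList (List.∷-injectiveˡ eq))) (groupings-complete I gs (List.∷-injectiveʳ eq))

  ungroup : List Block → Sentence
  ungroup gs = concat (map toList gs)

  letters : Sentence → Word
  letters I = concat (map toList I)

  prefix-unique : ∀ I J {X Y} → I ++ X ≡ J ++ Y → letters I ≡ letters J → I ≡ J
  prefix-unique []            []            _  _  = refl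
  prefix-unique []            ((_ ∷ _) ∷ J) _  ()
  prefix-unique ((_ ∷ _) ∷ I) []            _  ()
  prefix-unique (v ∷ I)       (w ∷ J)       eq eq′ with refl ← List.∷-injectiveˡ eq =
    cong (v ∷_) (prefix-unique I J (List.∷-injectiveʳ eq) (List.++-cancelˡ (toList v) _ _ eq′))

  letters-toList : ∀ g → letters (toList g) ≡ toList (List⁺.concat g)
  letters-toList ((_ ∷ _) ∷ _) = refl

  toList-injective : ∀ {b} {B : Set b} {g h : List⁺ B} → toList g ≡ toList h → g ≡ h
  toList-injective {g = _ ∷ _} {_ ∷ _} refl = refl

  ungroup-injective : ∀ gs hs → map List⁺.concat gs ≡ map List⁺.concat hs → ungroup gs ≡ ungroup hs → gs ≡ hs
  ungroup-injective []       []       _  _   = refl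
  ungroup-injective (g ∷ gs) (h ∷ hs) eq eq′
    with refl ← toList-injective {g = g} {h} (prefix-unique (toList g) (toList h) eq′
           (≡.trans (letters-toList g) (≡.trans (cong toList (List.∷-injectiveˡ eq)) (≡.sym (letters-toList h))))) =
    cong (g ∷_) (ungroup-injective gs hs (List.∷-injectiveʳ eq) (List.++-cancelˡ (toList g) _ _ eq′))

  map-unique : ∀ {x y} {X : Set x} {Y : Set y} (f : X → Y) xs →
               (∀ {u v} → u ∈ xs → v ∈ xs → f u ≡ f v → u ≡ v) → Unique xs → Unique (map f xs)
  map-unique f []       inj []         = []
  map-unique f (x ∷ xs) inj (x∉ ∷ xs!) =
    AllP.map⁺ (All.tabulate λ y∈ fx≡fy → All.lookup x∉ y∈ (inj (here refl) (there y∈) fx≡fy))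
    ∷ map-unique f xs (λ u∈ v∈ → inj (there u∈) (there v∈)) xs!

  refinements : ∀ I → Enumeration (_≼ I)
  refinements I = record
    { elements = map ungroup (groupings I)
    ; unique   = map-unique ungroup (groupings I)
        (λ {gs} {hs} gs∈ hs∈ → ungroup-injective gs hs
          (≡.trans (groupings-sound I gs∈) (≡.sym (groupings-sound I hs∈))))
        (groupings-unique I)
    ; ∈⇔       = mk⇔
        (λ J∈ → let (gs , gs∈ , eq) = ∈-map⁻ ungroup J∈ in gs , ≡.sym eq , groupings-sound I gs∈)
        (λ { (gs , refl , eq) → ∈-map⁺ ungroup (groupings-complete I gs eq) })
    }

module HopfAlgebraOfSentences {c ℓ₁ ℓ₂ a} (𝕜 : HeytingField c ℓ₁ ℓ₂) (A : Set a) (finite : Finite A) where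

  open Words A public

  _≟ₗ_ : DecidableEquality A
  _≟ₗ_ = inj⇒≟ (↔⇒↣ (proj₂ finite))

  _≟ₛ_ : DecidableEquality Sentence
  _≟ₛ_ = List.≡-dec λ { (a ∷ v) (b ∷ w) →
    map′ (λ { refl → refl }) (λ { refl → refl }) (×-≡-dec _≟ₗ_ (List.≡-dec _≟ₗ_) (a , v) (b , w)) }

  open FreeModule 𝕜 _≟ₛ_ public

  -- The tensor square of a space with basis the sentences has basis the pairs
  -- of sentences.
  module Tensor = FreeModule 𝕜 (×-≡-dec _≟ₛ_ _≟ₛ_)

  open CommutativeRing 𝕜-commutativeRing using (_*_; -_; 0#; 1#; ring; semiring) renaming (Carrier to K)
  open SemiringExp semiring using (_^_)

  H : Set (c ⊔ a)
  H = Vect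

  H⊗H : Set (c ⊔ a)
  H⊗H = Tensor.Vect

  infixr 7 _⊗_
  _⊗_ : H → H → H⊗H
  _⊗_ = cartesianProductWith λ (k , I) (l , J) → k * l , (I , J)

  μ : H⊗H → H
  μ = Tensor.extend leftModule λ (I , J) → basis (I ++ J)

  η : K → H
  η k = k • basis []

  Δ-basis : Sentence → H⊗H
  Δ-basis I = Tensor.∑ (splittings I) λ ps →
    basis (tilde (map proj₁ ps)) ⊗ basis (tilde (map proj₂ ps))

  Δ : H → H⊗H
  Δ = extend Tensor.leftModule Δ-basis

  ε-basis : Sentence → K
  ε-basis []      = 1#
  ε-basis (_ ∷ _) = 0#

  ε : H → K
  ε = extend TensorUnit.leftModule ε-basis

  IsLinear : (H → H) → Set (c ⊔ a ⊔ ℓ₁)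
  IsLinear = IsLeftModuleHomomorphism
    where
    open LeftModule leftModule using (rawLeftModule)
    open ModuleMorphisms.LeftModuleMorphisms rawLeftModule rawLeftModule

  infixr 7 _⊗₁_
  _⊗₁_ : (H → H) → (H → H) → H⊗H → H⊗H
  S ⊗₁ T = Tensor.extend Tensor.leftModule λ (I , J) → S (basis I) ⊗ T (basis J)

  record IsAntipode (S : H → H) : Set (c ⊔ a ⊔ ℓ₁) where
    field
      isLinear : IsLinear S
      inverseˡ : ∀ x → μ ((S ⊗₁ id) (Δ x)) ≈ᵥ η (ε x)
      inverseʳ : ∀ x → μ ((id ⊗₁ S) (Δ x)) ≈ᵥ η (ε x)

  sign : Sentence → K
  sign J = (- 1#) ^ length J

{-# OPTIONS --safe #-}

-- Let T(I) be the right-hand side. Refining a sentence means refining its words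
-- independently, so T is anti-multiplicative for concatenation, T(I·J) = T(J)·T(I),
-- and on a one-word sentence w it is ψ(w) = Σ_{J≼w} (-1)^ℓ(J) J. Either there is
-- a break after the first letter of a word or there is none, which gives
--   ψ(abw) = -a·ψ(bw) + prefix_a(ψ(bw)),
-- where prefix_a writes a in front of the first word. By induction on the word,
-- Σ_{uv=w} ψ(u)·v and Σ_{uv=w} u·ψ(v) vanish for non-empty w. In the convolution
-- T * id the first word of a sentence contributes the innermost factor, so the
-- first sum makes T * id vanish on I ≠ 1; for id * T it is the last word and the
-- second sum. As Δ(I) = I ⊗ 1 + Σ I′ ⊗ I″ with |I′| < |I|, a linear map is
-- determined by its convolution with id on the right, hence antipodes are unique.
module Submission where

open import Defs
open import Algebra.Apartness.Bundles using (HeytingField)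
open import Algebra.Bundles using (CommutativeMonoid; CommutativeRing; Ring)
open import Algebra.Module.Bundles using (LeftModule)
import Algebra.Module.Construct.TensorUnit as TensorUnit
import Algebra.Module.Morphism.Construct.Composition as Composition
import Algebra.Module.Morphism.Structures as ModuleMorphisms
open import Algebra.Morphism.Structures using (module MonoidMorphisms; module GroupMorphisms)
import Algebra.Properties.CommutativeSemigroup as CommutativeSemigroupProperties
import Algebra.Properties.Group as GroupProperties
import Algebra.Properties.Ring as RingProperties
open import Data.Bool.Base using (true; false; if_then_else_)
open import Data.List.Base using (List; []; _∷_; _++_; map; cartesianProductWith; filter; foldr; length)
open import Data.List.NonEmpty.Base using (_∷_; _∷⁺_; toList)
import Data.List.Properties as List
open import Data.List.Membership.Propositional using (_∈_)
open import Data.List.Relation.Unary.Any using (here; there)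
open import Data.Nat.Base as ℕ using (ℕ; suc; _≤_; z≤n; s≤s)
import Data.Nat.Properties as ℕ
open import Data.Product.Base using (∃; _×_; _,_; map₁; proj₁; proj₂)
open import Data.Product.Properties using () renaming (≡-dec to ×-≡-dec)
open import Function.Base using (_∘_; id)
open import Relation.Binary.Definitions using (DecidableEquality)
open import Relation.Binary.PropositionalEquality as ≡ using (_≡_; _≢_; refl)
import Relation.Binary.Reasoning.Setoid as SetoidReasoning
open import Relation.Nullary using (does; yes; no; contradiction)
open import Relation.Nullary.Decidable using (¬?)

-- Finite sums in commutative monoids.

module ListSum {m ℓ} (M : CommutativeMonoid m ℓ) where

  open CommutativeMonoid M renaming (refl to ≈-refl; sym to ≈-sym; trans to ≈-trans)
  open CommutativeSemigroupProperties commutativeSemigroup using (interchange)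

  sum : ∀ {x} {X : Set x} → List X → (X → Carrier) → Carrier
  sum xs f = foldr _∙_ ε (map f xs)

  module _ {x} {X : Set x} where

    sum-cong-∈ : ∀ xs {f g : X → Carrier} → (∀ {x} → x ∈ xs → f x ≈ g x) → sum xs f ≈ sum xs g
    sum-cong-∈ []       f≈g = ≈-refl
    sum-cong-∈ (x ∷ xs) f≈g = ∙-cong (f≈g (here refl)) (sum-cong-∈ xs (f≈g ∘ there))

    sum-cong : ∀ xs {f g : X → Carrier} → (∀ x → f x ≈ g x) → sum xs f ≈ sum xs g
    sum-cong xs f≈g = sum-cong-∈ xs λ {x} _ → f≈g x

    sum-ε : ∀ (xs : List X) → sum xs (λ _ → ε) ≈ ε
    sum-ε []       = ≈-refl
    sum-ε (x ∷ xs) = ≈-trans (identityˡ _) (sum-ε xs)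

    sum-++ : ∀ xs ys (f : X → Carrier) → sum (xs ++ ys) f ≈ sum xs f ∙ sum ys f
    sum-++ []       ys f = ≈-sym (identityˡ _)
    sum-++ (x ∷ xs) ys f = ≈-trans (∙-congˡ (sum-++ xs ys f)) (≈-sym (assoc _ _ _))

    sum-∙ : ∀ xs (f g : X → Carrier) → sum xs (λ x → f x ∙ g x) ≈ sum xs f ∙ sum xs g
    sum-∙ []       f g = ≈-sym (identityˡ _)
    sum-∙ (x ∷ xs) f g = ≈-trans (∙-congˡ (sum-∙ xs f g)) (interchange _ _ _ _)

  sum-map : ∀ {x y} {X : Set x} {Y : Set y} xs (h : X → Y) f → sum (map h xs) f ≡ sum xs (f ∘ h)
  sum-map xs h f = ≡.cong (foldr _∙_ ε) (≡.sym (List.map-∘ xs))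

  sum-cartesianProductWith :
    ∀ {x y z} {X : Set x} {Y : Set y} {Z : Set z} (h : X → Y → Z) xs ys f →
    sum (cartesianProductWith h xs ys) f ≈ sum xs λ x → sum ys λ y → f (h x y)
  sum-cartesianProductWith h []       ys f = ≈-refl
  sum-cartesianProductWith h (x ∷ xs) ys f = ≈-trans
    (sum-++ (map (h x) ys) _ f)
    (∙-cong (reflexive (sum-map ys (h x) f)) (sum-cartesianProductWith h xs ys f))

  sum-swap : ∀ {x y} {X : Set x} {Y : Set y} xs ys (f : X → Y → Carrier) →
             sum xs (λ x → sum ys (f x)) ≈ sum ys (λ y → sum xs (λ x → f x y))
  sum-swap []       ys f = ≈-sym (sum-ε ys)
  sum-swap (x ∷ xs) ys f = ≈-trans (∙-congˡ (sum-swap xs ys f)) (≈-sym (sum-∙ ys (f x) _))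

module _ {m ℓm n ℓn} (M : CommutativeMonoid m ℓm) (N : CommutativeMonoid n ℓn) where

  private
    module M = CommutativeMonoid M
    module N = CommutativeMonoid N
    open MonoidMorphisms M.rawMonoid N.rawMonoid

  homo-sum : ∀ {f} → IsMonoidHomomorphism f → ∀ {x} {X : Set x} (xs : List X) g →
             f (ListSum.sum M xs g) N.≈ ListSum.sum N xs (f ∘ g)
  homo-sum f-homo []       g = IsMonoidHomomorphism.ε-homo f-homo
  homo-sum f-homo (x ∷ xs) g = N.trans (IsMonoidHomomorphism.homo f-homo _ _) (N.∙-congˡ (homo-sum f-homo xs g))

-- Linear maps between modules.

module Linear = ModuleMorphisms.LeftModuleMorphisms.IsLeftModuleHomomorphism

module _ {r ℓr} {R : Ring r ℓr} where

  open Ring R using (Carrier; 0#; -_) renaming (_≈_ to _≈ᴿ_)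
  open LeftModule

  Linear : ∀ {m ℓm n ℓn} (M : LeftModule R m ℓm) (N : LeftModule R n ℓn) → (Carrierᴹ M → Carrierᴹ N) → Set _
  Linear M N = ModuleMorphisms.LeftModuleMorphisms.IsLeftModuleHomomorphism (rawLeftModule M) (rawLeftModule N)

  module _ {m ℓm n ℓn} (M : LeftModule R m ℓm) (N : LeftModule R n ℓn) where

    private
      module M = LeftModule M
      module N = LeftModule N

    -- Zero is preserved because it is `0#` times itself; then `f (-x) + f x` is the image of zero,
    -- so `f` preserves negatives by uniqueness of inverses.
    mkLinear : (f : M.Carrierᴹ → N.Carrierᴹ) →
               (∀ {x y} → x M.≈ᴹ y → f x N.≈ᴹ f y) →
               (∀ x y → f (x M.+ᴹ y) N.≈ᴹ f x N.+ᴹ f y) →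
               (∀ k x → f (k M.*ₗ x) N.≈ᴹ k N.*ₗ f x) →
               Linear M N f
    mkLinear f f-cong f-+ f-* = record
      { +ᴹ-isGroupHomomorphism = record
        { isMonoidHomomorphism = record
          { isMagmaHomomorphism = record { isRelHomomorphism = record { cong = f-cong } ; homo = f-+ }
          ; ε-homo = f-0
          }
        ; ⁻¹-homo = λ x → inverseˡ-unique _ _ (N.≈ᴹ-trans (N.≈ᴹ-sym (f-+ _ _)) (N.≈ᴹ-trans (f-cong (M.-ᴹ‿inverseˡ x)) f-0))
        }
      ; *ₗ-homo = f-*
      }
      where
      open GroupProperties N.+ᴹ-group using (inverseˡ-unique)
      f-0 : f M.0ᴹ N.≈ᴹ N.0ᴹ
      f-0 = N.≈ᴹ-trans (f-cong (M.≈ᴹ-sym (M.*ₗ-zeroˡ M.0ᴹ))) (N.≈ᴹ-trans (f-* 0# M.0ᴹ) (N.*ₗ-zeroˡ _))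

-- The universal property of the free module.

module FreeModuleProperties {c ℓ₁ ℓ₂} (𝕜 : HeytingField c ℓ₁ ℓ₂) {b} {B : Set b} (_≟_ : DecidableEquality B) where

  open FreeModule 𝕜 _≟_
  private module K = CommutativeRing 𝕜-commutativeRing
  open K using (0#; 1#; _*_; _+_)

  -- Vectors are lists of terms, with repeated basis elements allowed. That extend
  -- depends on the coefficients only is proved by collecting the terms at one
  -- basis element at a time.
  erase : B → Vect → Vect
  erase b = filter λ (_ , b′) → ¬? (b′ ≟ b)

  module _ {m ℓm} (M : LeftModule K.ring m ℓm) where

    open LeftModule M
    open CommutativeSemigroupProperties (CommutativeMonoid.commutativeSemigroup +ᴹ-commutativeMonoid) using (x∙yz≈y∙xz; interchange)
    open SetoidReasoning ≈ᴹ-setoid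

    extend-cong-fun : ∀ {f g} → (∀ b → f b ≈ᴹ g b) → ∀ x → extend M f x ≈ᴹ extend M g x
    extend-cong-fun f≈g []            = ≈ᴹ-refl
    extend-cong-fun f≈g ((k , b) ∷ x) = +ᴹ-cong (*ₗ-congˡ (f≈g b)) (extend-cong-fun f≈g x)

    extend-+-fun : ∀ f g x → extend M (λ b → f b +ᴹ g b) x ≈ᴹ extend M f x +ᴹ extend M g x
    extend-+-fun f g []            = ≈ᴹ-sym (+ᴹ-identityˡ _)
    extend-+-fun f g ((k , b) ∷ x) = ≈ᴹ-trans (+ᴹ-cong (*ₗ-distribˡ k _ _) (extend-+-fun f g x)) (interchange _ _ _ _)

    module _ (f : B → Carrierᴹ) where

      extend-basis : ∀ b → extend M f (basis b) ≈ᴹ f b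
      extend-basis b = ≈ᴹ-trans (+ᴹ-identityʳ _) (*ₗ-identityˡ _)

      extend-+ : ∀ x y → extend M f (x +ᵥ y) ≈ᴹ extend M f x +ᴹ extend M f y
      extend-+ []            y = ≈ᴹ-sym (+ᴹ-identityˡ _)
      extend-+ ((k , b) ∷ x) y = ≈ᴹ-trans (+ᴹ-congˡ (extend-+ x y)) (≈ᴹ-sym (+ᴹ-assoc _ _ _))

      extend-• : ∀ k x → extend M f (k • x) ≈ᴹ k *ₗ extend M f x
      extend-• k []            = ≈ᴹ-sym (*ₗ-zeroʳ k)
      extend-• k ((l , b) ∷ x) = ≈ᴹ-trans (+ᴹ-cong (*ₗ-assoc k l _) (extend-• k x)) (≈ᴹ-sym (*ₗ-distribˡ k _ _))

      extend-erase : ∀ b x → extend M f x ≈ᴹ coeff x b *ₗ f b +ᴹ extend M f (erase b x)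
      extend-erase b []             = ≈ᴹ-sym (≈ᴹ-trans (+ᴹ-identityʳ _) (*ₗ-zeroˡ _))
      extend-erase b ((k , b′) ∷ x) with b′ ≟ b
      ... | yes refl = begin
        k *ₗ f b +ᴹ extend M f x                                      ≈⟨ +ᴹ-congˡ (extend-erase b x) ⟩
        k *ₗ f b +ᴹ (coeff x b *ₗ f b +ᴹ extend M f (erase b x))      ≈⟨ +ᴹ-assoc _ _ _ ⟨
        k *ₗ f b +ᴹ coeff x b *ₗ f b +ᴹ extend M f (erase b x)        ≈⟨ +ᴹ-congʳ (*ₗ-distribʳ _ _ _) ⟨
        (k + coeff x b) *ₗ f b +ᴹ extend M f (erase b x)              ∎
      ... | no _ = begin
        k *ₗ f b′ +ᴹ extend M f x                                     ≈⟨ +ᴹ-congˡ (extend-erase b x) ⟩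
        k *ₗ f b′ +ᴹ (coeff x b *ₗ f b +ᴹ extend M f (erase b x))     ≈⟨ x∙yz≈y∙xz _ _ _ ⟩
        coeff x b *ₗ f b +ᴹ (k *ₗ f b′ +ᴹ extend M f (erase b x))     ≈⟨ +ᴹ-congʳ (*ₗ-congʳ (K.+-identityˡ _)) ⟨
        (0# + coeff x b) *ₗ f b +ᴹ (k *ₗ f b′ +ᴹ extend M f (erase b x)) ∎

  -- The coefficient at `c` is itself an extension to the scalars, of the Kronecker delta at `c`, so
  -- `extend-erase` applies to it.
  coeff-erase : ∀ b x c → coeff x c K.≈ coeff x b * (if does (b ≟ c) then 1# else 0#) + coeff (erase b x) c
  coeff-erase b x c = K.trans (coeff≈extend x)
    (K.trans (extend-erase TensorUnit.leftModule _ b x) (K.+-congˡ (K.sym (coeff≈extend (erase b x)))))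
    where
    coeff≈extend : ∀ x → coeff x c K.≈ extend TensorUnit.leftModule (λ b → if does (b ≟ c) then 1# else 0#) x
    coeff≈extend []            = K.refl
    coeff≈extend ((k , b) ∷ x) = K.+-cong lemma (coeff≈extend x)
      where
      lemma : (if does (b ≟ c) then k else 0#) K.≈ k * (if does (b ≟ c) then 1# else 0#)
      lemma with b ≟ c
      ... | yes _ = K.sym (K.*-identityʳ k)
      ... | no  _ = K.sym (K.zeroʳ k)

  erase-0 : ∀ b x → x ≈ᵥ 0ᵥ → erase b x ≈ᵥ 0ᵥ
  erase-0 b x x≈0 = coeffs≈ λ c → K.sym (K.trans (K.sym (coeff≈ x≈0 c))
    (K.trans (coeff-erase b x c) (K.trans (K.+-congʳ (K.trans (K.*-congʳ (coeff≈ x≈0 b)) (K.zeroˡ _))) (K.+-identityˡ _))))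

  module _ {m ℓm} (M : LeftModule K.ring m ℓm) (f : B → LeftModule.Carrierᴹ M) where

    open LeftModule M
    open GroupProperties +ᴹ-group using (inverseˡ-unique; x∙y⁻¹≈ε⇒x≈y)

    -- Erasing the basis element of the head term removes a total contribution of zero and leaves a
    -- zero vector. The bound `n` carries the recursion, as `erase b x` is not a structural subterm
    -- of `x`.
    extend-0 : ∀ n x → length x ≤ n → x ≈ᵥ 0ᵥ → extend M f x ≈ᴹ 0ᴹ
    extend-0 _       []             _         _   = ≈ᴹ-refl
    extend-0 (suc n) x@((k , b) ∷ x′) (s≤s len) x≈0 = ≈ᴹ-trans (extend-erase M f b x)
      (≈ᴹ-trans (+ᴹ-cong (≈ᴹ-trans (*ₗ-congʳ (coeff≈ x≈0 b)) (*ₗ-zeroˡ _))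
        (extend-0 n (erase b x)
          -- Strictly shorter: the head term, whose basis element is `b`, is filtered out.
          (ℕ.≤-trans (ℕ.≤-pred (List.filter-notAll (λ (_ , b′) → ¬? (b′ ≟ b)) x (here λ b≢b → b≢b refl))) len)
          (erase-0 b x x≈0)))
        (+ᴹ-identityˡ _))

    -- Reduces to `extend-0` for the difference of the two vectors. Compatibility with negation also
    -- comes from `extend-0`, since linearity is only available afterwards.
    extend-cong : ∀ {x y} → x ≈ᵥ y → extend M f x ≈ᴹ extend M f y
    extend-cong {x} {y} x≈y = x∙y⁻¹≈ε⇒x≈y _ _ (≈ᴹ-trans (+ᴹ-congˡ (≈ᴹ-sym extend-neg))
        (≈ᴹ-trans (≈ᴹ-sym (extend-+ M f x (-ᵥ y)))
          (extend-0 _ _ ℕ.≤-refl (V.≈ᴹ-trans (V.+ᴹ-congʳ x≈y) (V.-ᴹ‿inverseʳ y)))))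
      where
      module V = LeftModule leftModule
      extend-neg : extend M f (-ᵥ y) ≈ᴹ -ᴹ extend M f y
      extend-neg = inverseˡ-unique _ _ (≈ᴹ-trans (≈ᴹ-sym (extend-+ M f (-ᵥ y) y))
        (extend-0 _ _ ℕ.≤-refl (V.-ᴹ‿inverseˡ y)))

    extend-linear : Linear leftModule M (extend M f)
    extend-linear = mkLinear leftModule M (extend M f) extend-cong (extend-+ M f) (extend-• M f)

  -- This reduces an identity between linear maps to basis elements; associativity of the product
  -- and the convolution formula are both proved through it.
  linear-extend : ∀ {m ℓm n ℓn} (M : LeftModule K.ring m ℓm) (N : LeftModule K.ring n ℓn) {h} →
                  Linear M N h → ∀ f x → LeftModule._≈ᴹ_ N (h (extend M f x)) (extend N (h ∘ f) x)
  linear-extend M N h-lin f [] = Linear.0ᴹ-homo h-lin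
  linear-extend M N h-lin f ((k , b) ∷ x) = N.≈ᴹ-trans (Linear.+ᴹ-homo h-lin _ _)
    (N.+ᴹ-cong (Linear.*ₗ-homo h-lin k _) (linear-extend M N h-lin f x))
    where module N = LeftModule N

  single-cong : ∀ {k l} b → k K.≈ l → ((k , b) ∷ []) ≈ᵥ ((l , b) ∷ [])
  single-cong b k≈l = coeffs≈ λ c → K.+-congʳ (if-cong c)
    where
    if-cong : ∀ c → (if does (b ≟ c) then _ else 0#) K.≈ (if does (b ≟ c) then _ else 0#)
    if-cong c with does (b ≟ c)
    ... | true  = k≈l
    ... | false = K.refl

  extend-basis-id : ∀ x → extend leftModule basis x ≈ᵥ x
  extend-basis-id []            = LeftModule.≈ᴹ-refl leftModule
  extend-basis-id ((k , b) ∷ x) = LeftModule.+ᴹ-cong leftModule (single-cong b (K.*-identityʳ k)) (extend-basis-id x)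

-- Distributivity over finite sums and ring identities.

module RingSum {r ℓ} (R : Ring r ℓ) where

  open Ring R renaming (refl to ≈-refl; sym to ≈-sym; trans to ≈-trans)
  open RingProperties R
  open ListSum +-commutativeMonoid
  open SetoidReasoning setoid

  *-sum : ∀ {x} {X : Set x} y xs (f : X → Carrier) → y * sum xs f ≈ sum xs λ x → y * f x
  *-sum y []       f = zeroʳ y
  *-sum y (x ∷ xs) f = ≈-trans (distribˡ _ _ _) (+-congˡ (*-sum y xs f))

  sum-* : ∀ {x} {X : Set x} y xs (f : X → Carrier) → sum xs f * y ≈ sum xs λ x → f x * y
  sum-* y []       f = zeroˡ y
  sum-* y (x ∷ xs) f = ≈-trans (distribʳ _ _ _) (+-congˡ (sum-* y xs f))

  xy+[x[-y]+z]≈z : ∀ x y z → x * y + (x * (- y) + z) ≈ z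
  xy+[x[-y]+z]≈z x y z = begin
    x * y + (x * (- y) + z)   ≈⟨ +-assoc _ _ _ ⟨
    x * y + x * (- y) + z     ≈⟨ +-congʳ (distribˡ x y (- y)) ⟨
    x * (y + - y) + z         ≈⟨ +-congʳ (≈-trans (*-congˡ (-‿inverseʳ y)) (zeroʳ x)) ⟩
    0# + z                    ≈⟨ +-identityˡ z ⟩
    z                         ∎

  xy-z≈-[-xy+z] : ∀ x y z → x * y + - z ≈ - (- x * y + z)
  xy-z≈-[-xy+z] x y z = begin
    x * y + - z               ≈⟨ +-congʳ (-‿involutive _) ⟨
    - - (x * y) + - z         ≈⟨ +-congʳ (-‿cong (-‿distribˡ-* x y)) ⟩
    - (- x * y) + - z         ≈⟨ -‿+-comm _ _ ⟩
    - (- x * y + z)           ∎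

  xy·zt≈x·yz·t : ∀ x y z t → (x * y) * (z * t) ≈ x * ((y * z) * t)
  xy·zt≈x·yz·t x y z t = begin
    (x * y) * (z * t)   ≈⟨ *-assoc _ _ _ ⟩
    x * (y * (z * t))   ≈⟨ *-congˡ (*-assoc _ _ _) ⟨
    x * ((y * z) * t)   ∎

-- Convolution of functions on sentences and the grading by letters.

module Convolution {r ℓ a} (R : Ring r ℓ) (A : Set a) where

  open Words A
  open Ring R renaming (refl to ≈-refl; sym to ≈-sym; trans to ≈-trans)
  open ListSum +-commutativeMonoid
  open RingSum R
  open SetoidReasoning setoid

  -- The convolution product of linear maps, each given by its values on sentences; `convolution`
  -- later relates it to `μ` and `Δ`.
  conv : (Sentence → Carrier) → (Sentence → Carrier) → Sentence → Carrier
  conv f g I = sum (allSplittings I) λ ps → f (tilde (map proj₁ ps)) * g (tilde (map proj₂ ps))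

  conv-cong : ∀ {f f′ g g′} → (∀ I → f I ≈ f′ I) → (∀ I → g I ≈ g′ I) → ∀ I → conv f g I ≈ conv f′ g′ I
  conv-cong f≈ g≈ I = sum-cong (allSplittings I) λ ps → *-cong (f≈ _) (g≈ _)

  counit : Sentence → Carrier
  counit []      = 1#
  counit (_ ∷ _) = 0#

  sum-wordSplittings-∷ : ∀ a w (f : Word × Word → Carrier) →
    sum (wordSplittings (a ∷ w)) f ≈ f ([] , a ∷ w) + sum (wordSplittings w) λ (u , v) → f (a ∷ u , v)
  sum-wordSplittings-∷ a w f = +-congˡ (reflexive (sum-map (wordSplittings w) (map₁ (a ∷_)) f))

  size : Sentence → ℕ
  size I = length (letters I)

  letters-tilde-∷ : ∀ u us → letters (tilde (u ∷ us)) ≡ u ++ letters (tilde us)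
  letters-tilde-∷ []      us = refl
  letters-tilde-∷ (a ∷ u) us = refl

  -- The comultiplication is homogeneous: a splitting distributes the letters of each word over its
  -- two halves, and `tilde` deletes no letter.
  size-splitting : ∀ I ps → IsSplitting I ps →
                   size (tilde (map proj₁ ps)) ℕ.+ size (tilde (map proj₂ ps)) ≡ size I
  size-splitting []      []             eq = refl
  size-splitting (w ∷ I) ((u , v) ∷ ps) eq = ≡.trans
    (≡.cong₂ ℕ._+_ (size-∷ u (map proj₁ ps)) (size-∷ v (map proj₂ ps)))
    (≡.trans (ℕ-interchange (length u) _ (length v) _)
    (≡.trans (≡.cong₂ ℕ._+_
      (≡.trans (≡.sym (List.length-++ u)) (≡.cong length (List.∷-injectiveˡ eq)))
      (size-splitting I ps (List.∷-injectiveʳ eq)))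
    (≡.sym (List.length-++ (toList w)))))
    where
    open CommutativeSemigroupProperties ℕ.+-commutativeSemigroup using () renaming (interchange to ℕ-interchange)
    size-∷ : ∀ u us → size (tilde (u ∷ us)) ≡ length u ℕ.+ size (tilde us)
    size-∷ u us = ≡.trans (≡.cong length (letters-tilde-∷ u us)) (List.length-++ u)

  size-positive : ∀ J → J ≢ [] → 0 ℕ.< size J
  size-positive []            J≢[] = contradiction refl J≢[]
  size-positive ((_ ∷ _) ∷ _) _    = s≤s z≤n

  -- The splitting whose summand in Δ(I) is I ⊗ 1.
  trivialSplitting : Sentence → List (Word × Word)
  trivialSplitting = map λ w → toList w , []

  tilde-trivialSplitting₁ : ∀ I → tilde (map proj₁ (trivialSplitting I)) ≡ I
  tilde-trivialSplitting₁ []      = refl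
  tilde-trivialSplitting₁ (w ∷ I) = ≡.cong (w ∷_) (tilde-trivialSplitting₁ I)

  tilde-trivialSplitting₂ : ∀ I → tilde (map proj₂ (trivialSplitting I)) ≡ []
  tilde-trivialSplitting₂ []      = refl
  tilde-trivialSplitting₂ (w ∷ I) = tilde-trivialSplitting₂ I

  sum-wordSplittings-trivial : ∀ w f → (∀ u b v → u ++ b ∷ v ≡ w → f (u , b ∷ v) ≈ 0#) →
                               sum (wordSplittings w) f ≈ f (w , [])
  sum-wordSplittings-trivial []      f f≈0 = +-identityʳ _
  sum-wordSplittings-trivial (a ∷ w) f f≈0 = ≈-trans (sum-wordSplittings-∷ a w f)
    (≈-trans (+-cong (f≈0 [] a w refl)
      (sum-wordSplittings-trivial w (f ∘ map₁ (a ∷_)) λ u b v eq → f≈0 (a ∷ u) b v (≡.cong (a ∷_) eq)))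
      (+-identityˡ _))

  -- The right-hand sentence is empty only if every right half is. Word by word, a non-empty right
  -- half kills the summand, which leaves the single choice `(toList w , [])`.
  sum-allSplittings-trivial : ∀ I f → (∀ ps → IsSplitting I ps → tilde (map proj₂ ps) ≢ [] → f ps ≈ 0#) →
                              sum (allSplittings I) f ≈ f (trivialSplitting I)
  sum-allSplittings-trivial []      f f≈0 = +-identityʳ _
  sum-allSplittings-trivial (w ∷ I) f f≈0 = begin
    sum (allSplittings (w ∷ I)) f
      ≈⟨ sum-cartesianProductWith _∷_ (wordSplittings (toList w)) (allSplittings I) f ⟩
    sum (wordSplittings (toList w)) (λ p → sum (allSplittings I) λ ps → f (p ∷ ps))
      ≈⟨ sum-wordSplittings-trivial (toList w) _ (λ u b v eq → ≈-trans
           (sum-cong-∈ (allSplittings I) λ {ps} ps∈ →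
             -- `tilde` keeps the non-empty word `b ∷ v`, so the right-hand sentence cannot be
             -- empty.
             f≈0 ((u , b ∷ v) ∷ ps) (≡.cong₂ _∷_ eq (allSplittings-sound I ps∈)) λ ())
           (sum-ε (allSplittings I))) ⟩
    sum (allSplittings I) (λ ps → f ((toList w , []) ∷ ps))
      ≈⟨ sum-allSplittings-trivial I _ (λ ps split → f≈0 ((toList w , []) ∷ ps)
           (≡.cong₂ _∷_ (List.++-identityʳ (toList w)) split)) ⟩
    f (trivialSplitting (w ∷ I))
      ∎

  -- Cancellation of a right convolution factor.

  module _ {ι : Sentence → Carrier} (ι-[] : ι [] ≈ 1#) where

    -- Strong induction on the number of letters. Every non-trivial splitting evaluates `d` at a
    -- sentence with fewer letters, where it already vanishes, so only `d I * ι []` remains.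
    conv-cancel-0 : ∀ {d} → (∀ I → conv d ι I ≈ 0#) → ∀ I → d I ≈ 0#
    conv-cancel-0 {d} conv≈0 I = bounded (suc (size I)) I ℕ.≤-refl
      where
      bounded : ∀ n I → size I ℕ.< n → d I ≈ 0#
      bounded (suc n) I (s≤s size≤n) = begin
        d I
          ≈⟨ *-identityʳ _ ⟨
        d I * 1#
          ≈⟨ *-congˡ ι-[] ⟨
        d I * ι []
          ≡⟨ ≡.cong₂ (λ I J → d I * ι J) (tilde-trivialSplitting₁ I) (tilde-trivialSplitting₂ I) ⟨
        d (tilde (map proj₁ (trivialSplitting I))) * ι (tilde (map proj₂ (trivialSplitting I)))
          ≈⟨ sum-allSplittings-trivial I _ (λ ps split vs≢[] → ≈-trans
               (*-congʳ (bounded n _ (ℕ.<-≤-trans (smaller ps split vs≢[]) size≤n))) (zeroˡ _)) ⟨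
        conv d ι I
          ≈⟨ conv≈0 I ⟩
        0#
          ∎
        where
        smaller : ∀ ps → IsSplitting I ps → tilde (map proj₂ ps) ≢ [] → size (tilde (map proj₁ ps)) ℕ.< size I
        smaller ps split vs≢[] = ≡.subst (_ ℕ.<_) (size-splitting I ps split)
          (ℕ.m<m+n (size (tilde (map proj₁ ps))) (size-positive (tilde (map proj₂ ps)) vs≢[]))

    conv-cancel : ∀ {f g} → (∀ I → conv f ι I ≈ conv g ι I) → ∀ I → f I ≈ g I
    conv-cancel {f} {g} f≈g I = x∙y⁻¹≈ε⇒x≈y _ _ (conv-cancel-0 {λ J → f J - g J} difference I)
      where
      open GroupProperties +-group using (x∙y⁻¹≈ε⇒x≈y; ∙-cancelʳ; //-rightDividesˡ)

      difference : ∀ I → conv (λ J → f J - g J) ι I ≈ 0#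
      -- Adding `conv g ι I` to both sides turns the difference back into `f`, so only additivity of
      -- convolution is needed.
      difference I = ∙-cancelʳ (conv g ι I) _ _ (begin
        conv (λ J → f J - g J) ι I + conv g ι I
          ≈⟨ sum-∙ (allSplittings I) _ _ ⟨
        sum (allSplittings I) (λ ps → (f (U ps) - g (U ps)) * ι (V ps) + g (U ps) * ι (V ps))
          ≈⟨ sum-cong (allSplittings I) (λ ps → ≈-trans (≈-sym (distribʳ _ _ _)) (*-congʳ (//-rightDividesˡ _ _))) ⟩
        conv f ι I
          ≈⟨ f≈g I ⟩
        conv g ι I
          ≈⟨ +-identityˡ _ ⟨
        0# + conv g ι I
          ∎)
        where
        U V : List (Word × Word) → Sentence
        U ps = tilde (map proj₁ ps)
        V ps = tilde (map proj₂ ps)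

-- Signed refinement sums of a single word.

-- The ring is abstract, with ι in the role of basis, because the operations of the
-- free module compute on lists and so block unification in the ring laws.
module RefinementSum {r ℓ a} (R : Ring r ℓ) (A : Set a)
  (ι : Words.Sentence A → Ring.Carrier R)
  (ι-[] : Ring._≈_ R (ι []) (Ring.1# R))
  (ι-++ : ∀ I J → Ring._≈_ R (ι (I ++ J)) (Ring._*_ R (ι I) (ι J)))
  (prefix : A → Ring.Carrier R → Ring.Carrier R)
  (prefix-homo : ∀ a → GroupMorphisms.IsGroupHomomorphism (Ring.+-rawGroup R) (Ring.+-rawGroup R) (prefix a))
  (prefix-ι-* : ∀ a v I y → Ring._≈_ R (prefix a (Ring._*_ R (ι (v ∷ I)) y)) (Ring._*_ R (ι ((a ∷⁺ v) ∷ I)) y))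
  where

  open Words A
  open Ring R renaming (refl to ≈-refl; sym to ≈-sym; trans to ≈-trans)
  open RingProperties R
  open ListSum +-commutativeMonoid
  open RingSum R
  open Convolution R A
  open SetoidReasoning setoid
  private module Prefix a = GroupMorphisms.IsGroupHomomorphism (prefix-homo a)

  prefix-sum : ∀ a {x} {X : Set x} (xs : List X) f → prefix a (sum xs f) ≈ sum xs (prefix a ∘ f)
  prefix-sum a = homo-sum +-commutativeMonoid +-commutativeMonoid (Prefix.isMonoidHomomorphism a)

  -- One minus sign per word, in place of a global power of -1, makes this multiplicative;
  -- `sign-basis` identifies it with the signed basis vector.
  signed : Sentence → Carrier
  signed []      = 1#
  signed (w ∷ I) = - ι (w ∷ []) * signed I

  signed-++ : ∀ I J → signed (I ++ J) ≈ signed I * signed J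
  signed-++ []      J = ≈-sym (*-identityˡ _)
  signed-++ (w ∷ I) J = ≈-trans (*-congˡ (signed-++ I J)) (≈-sym (*-assoc _ _ _))

  -- Through `tilde` the empty word denotes the unit, so splittings with an empty half fit the same
  -- formulas.
  ⟦_⟧ : Word → Carrier
  ⟦ v ⟧ = ι (tilde (v ∷ []))

  -- The value at the empty word is that of the empty sentence, which is what `tilde` leaves of an
  -- empty word.
  ψ : Word → Carrier
  ψ []      = 1#
  ψ (a ∷ w) = sum (blocks a w) λ g → signed (toList g)

  prefix-ι : ∀ a v I → prefix a (ι (v ∷ I)) ≈ ι ((a ∷⁺ v) ∷ I)
  prefix-ι a v I = ≈-trans (Prefix.⟦⟧-cong a (≈-sym (*-identityʳ _))) (≈-trans (prefix-ι-* a v I 1#) (*-identityʳ _))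

  -- `prefix a` changes only the first word, which lies in the left factor because a block is
  -- non-empty. The sign is moved outside so that `prefix-ι-*` applies.
  prefix-signed-* : ∀ a g y → prefix a (signed (toList g) * y) ≈ signed (toList (glue a g)) * y
  prefix-signed-* a (v ∷ I) y = begin
    prefix a (- ι (v ∷ []) * signed I * y)        ≈⟨ Prefix.⟦⟧-cong a (shuffle v) ⟨
    prefix a (- (ι (v ∷ []) * (signed I * y)))    ≈⟨ Prefix.⁻¹-homo a _ ⟩
    - prefix a (ι (v ∷ []) * (signed I * y))      ≈⟨ -‿cong (prefix-ι-* a v [] _) ⟩
    - (ι ((a ∷⁺ v) ∷ []) * (signed I * y))        ≈⟨ shuffle (a ∷⁺ v) ⟩
    - ι ((a ∷⁺ v) ∷ []) * signed I * y            ∎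
    where
    shuffle : ∀ w → - (ι (w ∷ []) * (signed I * y)) ≈ - ι (w ∷ []) * signed I * y
    shuffle w = ≈-trans (-‿distribˡ-* _ _) (≈-sym (*-assoc _ _ _))

  ψ-[] : ∀ a → ψ (a ∷ []) ≈ - ⟦ a ∷ [] ⟧
  ψ-[] a = ≈-trans (+-identityʳ _) (*-identityʳ _)

  -- Commuting with right multiplication can fail at the unit, but `ψ (b ∷ w)` is a combination of
  -- non-empty sentences.
  prefix-ψ-* : ∀ a b w y → prefix a (ψ (b ∷ w) * y) ≈ prefix a (ψ (b ∷ w)) * y
  prefix-ψ-* a b w y = begin
    prefix a (ψ (b ∷ w) * y)                                           ≈⟨ prefix-sum-* y ⟩
    -- The instance `y = 1#` of the same identity recognises this sum as `prefix a (ψ (b ∷ w))`.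
    sum (blocks b w) (λ g → signed (toList (glue a g))) * y            ≈⟨ *-congʳ (*-identityʳ _) ⟨
    sum (blocks b w) (λ g → signed (toList (glue a g))) * 1# * y       ≈⟨ *-congʳ (prefix-sum-* 1#) ⟨
    prefix a (ψ (b ∷ w) * 1#) * y                                      ≈⟨ *-congʳ (Prefix.⟦⟧-cong a (*-identityʳ _)) ⟩
    prefix a (ψ (b ∷ w)) * y                                           ∎
    where
    prefix-sum-* : ∀ y → prefix a (ψ (b ∷ w) * y) ≈ sum (blocks b w) (λ g → signed (toList (glue a g))) * y
    prefix-sum-* y = begin
      prefix a (ψ (b ∷ w) * y)                                         ≈⟨ Prefix.⟦⟧-cong a (sum-* y (blocks b w) _) ⟩
      prefix a (sum (blocks b w) λ g → signed (toList g) * y)          ≈⟨ prefix-sum a (blocks b w) _ ⟩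
      sum (blocks b w) (λ g → prefix a (signed (toList g) * y))        ≈⟨ sum-cong (blocks b w) (λ g → prefix-signed-* a g y) ⟩
      sum (blocks b w) (λ g → signed (toList (glue a g)) * y)          ≈⟨ sum-* y (blocks b w) _ ⟨
      sum (blocks b w) (λ g → signed (toList (glue a g))) * y          ∎

  -- The two terms come from the two halves of `blocks a (b ∷ w)`: a cut contributes the factor
  -- `- ⟦ a ∷ [] ⟧`, a glueing becomes `prefix a`.
  ψ-∷ : ∀ a b w → ψ (a ∷ b ∷ w) ≈ - ⟦ a ∷ [] ⟧ * ψ (b ∷ w) + prefix a (ψ (b ∷ w))
  ψ-∷ a b w = begin
    ψ (a ∷ b ∷ w)
      ≈⟨ sum-++ (map (cut a) (blocks b w)) _ _ ⟩
    sum (map (cut a) (blocks b w)) (signed ∘ toList) + sum (map (glue a) (blocks b w)) (signed ∘ toList)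
      ≡⟨ ≡.cong₂ _+_ (sum-map (blocks b w) (cut a) _) (sum-map (blocks b w) (glue a) _) ⟩
    sum (blocks b w) (λ g → - ⟦ a ∷ [] ⟧ * signed (toList g)) + sum (blocks b w) (λ g → signed (toList (glue a g)))
      ≈⟨ +-cong (*-sum (- ⟦ a ∷ [] ⟧) (blocks b w) _) (sum-cong (blocks b w) prefix-signed) ⟨
    - ⟦ a ∷ [] ⟧ * ψ (b ∷ w) + sum (blocks b w) (λ g → prefix a (signed (toList g)))
      ≈⟨ +-congˡ (prefix-sum a (blocks b w) _) ⟨
    - ⟦ a ∷ [] ⟧ * ψ (b ∷ w) + prefix a (ψ (b ∷ w))
      ∎
    where
    prefix-signed : ∀ g → prefix a (signed (toList g)) ≈ signed (toList (glue a g))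
    prefix-signed g = ≈-trans (Prefix.⟦⟧-cong a (≈-sym (*-identityʳ _)))
      (≈-trans (prefix-signed-* a g 1#) (*-identityʳ _))

  -- These are the splittings of `a ∷ w` with non-empty left half; they must cancel the remaining
  -- term `⟦ a ∷ w ⟧`. The induction on the word uses the recurrence `ψ-∷`.
  sum-ψ-⟦⟧ : ∀ a w → sum (wordSplittings w) (λ (u , v) → ψ (a ∷ u) * ⟦ v ⟧) ≈ - ⟦ a ∷ w ⟧
  sum-ψ-⟦⟧ a []      = ≈-trans (+-identityʳ _) (≈-trans (*-congˡ ι-[]) (≈-trans (*-identityʳ _) (ψ-[] a)))
  sum-ψ-⟦⟧ a (b ∷ w) = begin
    sum (wordSplittings (b ∷ w)) (λ (u , v) → ψ (a ∷ u) * ⟦ v ⟧)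
      ≈⟨ sum-wordSplittings-∷ b w _ ⟩
    ψ (a ∷ []) * ⟦ b ∷ w ⟧ + sum (wordSplittings w) (λ (u , v) → ψ (a ∷ b ∷ u) * ⟦ v ⟧)
      ≈⟨ +-cong (*-congʳ (ψ-[] a)) (sum-cong (wordSplittings w) λ (u , v) → expand u v) ⟩
    m * ⟦ b ∷ w ⟧ + sum (wordSplittings w) (λ (u , v) → m * (ψ (b ∷ u) * ⟦ v ⟧) + prefix a (ψ (b ∷ u) * ⟦ v ⟧))
      ≈⟨ +-congˡ (sum-∙ (wordSplittings w) _ _) ⟩
    m * ⟦ b ∷ w ⟧ + (sum (wordSplittings w) (λ (u , v) → m * (ψ (b ∷ u) * ⟦ v ⟧))
                   + sum (wordSplittings w) (λ (u , v) → prefix a (ψ (b ∷ u) * ⟦ v ⟧)))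
      ≈⟨ +-congˡ (+-cong (*-sum m (wordSplittings w) _) (prefix-sum a (wordSplittings w) _)) ⟨
    m * ⟦ b ∷ w ⟧ + (m * x + prefix a x)
      ≈⟨ +-congˡ (+-cong (*-congˡ (sum-ψ-⟦⟧ b w)) (Prefix.⟦⟧-cong a (sum-ψ-⟦⟧ b w))) ⟩
    m * ⟦ b ∷ w ⟧ + (m * - ⟦ b ∷ w ⟧ + prefix a (- ⟦ b ∷ w ⟧))
      -- The splitting directly after `a` cancels the cut part; only the glued part survives.
      ≈⟨ xy+[x[-y]+z]≈z m ⟦ b ∷ w ⟧ _ ⟩
    prefix a (- ⟦ b ∷ w ⟧)
      ≈⟨ Prefix.⁻¹-homo a _ ⟩
    - prefix a ⟦ b ∷ w ⟧
      ≈⟨ -‿cong (prefix-ι a (b ∷ w) []) ⟩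
    - ⟦ a ∷ b ∷ w ⟧
      ∎
    where
    m x : Carrier
    m = - ⟦ a ∷ [] ⟧
    x = sum (wordSplittings w) λ (u , v) → ψ (b ∷ u) * ⟦ v ⟧

    expand : ∀ u v → ψ (a ∷ b ∷ u) * ⟦ v ⟧ ≈ m * (ψ (b ∷ u) * ⟦ v ⟧) + prefix a (ψ (b ∷ u) * ⟦ v ⟧)
    expand u v = begin
      ψ (a ∷ b ∷ u) * ⟦ v ⟧                                         ≈⟨ *-congʳ (ψ-∷ a b u) ⟩
      (m * ψ (b ∷ u) + prefix a (ψ (b ∷ u))) * ⟦ v ⟧                ≈⟨ distribʳ _ _ _ ⟩
      m * ψ (b ∷ u) * ⟦ v ⟧ + prefix a (ψ (b ∷ u)) * ⟦ v ⟧          ≈⟨ +-cong (*-assoc _ _ _) (≈-sym (prefix-ψ-* a b u _)) ⟩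
      m * (ψ (b ∷ u) * ⟦ v ⟧) + prefix a (ψ (b ∷ u) * ⟦ v ⟧)        ∎

  -- The splitting directly after `a` gives the cut term of `ψ-∷`, the later ones give its `prefix`
  -- term by induction, so the recurrence is read backwards.
  sum-⟦⟧-ψ : ∀ a w → sum (wordSplittings w) (λ (u , v) → ⟦ a ∷ u ⟧ * ψ v) ≈ - ψ (a ∷ w)
  sum-⟦⟧-ψ a []      = begin
    ⟦ a ∷ [] ⟧ * 1# + 0#   ≈⟨ +-identityʳ _ ⟩
    ⟦ a ∷ [] ⟧ * 1#        ≈⟨ *-identityʳ _ ⟩
    ⟦ a ∷ [] ⟧             ≈⟨ -‿involutive _ ⟨
    - - ⟦ a ∷ [] ⟧         ≈⟨ -‿cong (ψ-[] a) ⟨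
    - ψ (a ∷ [])           ∎
  sum-⟦⟧-ψ a (b ∷ w) = begin
    sum (wordSplittings (b ∷ w)) (λ (u , v) → ⟦ a ∷ u ⟧ * ψ v)
      ≈⟨ sum-wordSplittings-∷ b w _ ⟩
    ⟦ a ∷ [] ⟧ * ψ (b ∷ w) + sum (wordSplittings w) (λ (u , v) → ⟦ a ∷ b ∷ u ⟧ * ψ v)
      -- Each remaining left half starts with `a ∷ b`, so `a` can be detached by `prefix`.
      ≈⟨ +-congˡ (sum-cong (wordSplittings w) λ (u , v) → prefix-ι-* a (b ∷ u) [] (ψ v)) ⟨
    ⟦ a ∷ [] ⟧ * ψ (b ∷ w) + sum (wordSplittings w) (λ (u , v) → prefix a (⟦ b ∷ u ⟧ * ψ v))
      ≈⟨ +-congˡ (prefix-sum a (wordSplittings w) _) ⟨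
    ⟦ a ∷ [] ⟧ * ψ (b ∷ w) + prefix a (sum (wordSplittings w) λ (u , v) → ⟦ b ∷ u ⟧ * ψ v)
      ≈⟨ +-congˡ (Prefix.⟦⟧-cong a (sum-⟦⟧-ψ b w)) ⟩
    ⟦ a ∷ [] ⟧ * ψ (b ∷ w) + prefix a (- ψ (b ∷ w))
      ≈⟨ +-congˡ (Prefix.⁻¹-homo a _) ⟩
    ⟦ a ∷ [] ⟧ * ψ (b ∷ w) + - prefix a (ψ (b ∷ w))
      ≈⟨ xy-z≈-[-xy+z] _ _ _ ⟩
    - (- ⟦ a ∷ [] ⟧ * ψ (b ∷ w) + prefix a (ψ (b ∷ w)))
      ≈⟨ -‿cong (ψ-∷ a b w) ⟨
    - ψ (a ∷ b ∷ w)
      ∎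

  ψ-inverseˡ : ∀ w → sum (wordSplittings (toList w)) (λ (u , v) → ψ u * ⟦ v ⟧) ≈ 0#
  ψ-inverseˡ (a ∷ w) = begin
    sum (wordSplittings (a ∷ w)) (λ (u , v) → ψ u * ⟦ v ⟧)                            ≈⟨ sum-wordSplittings-∷ a w _ ⟩
    1# * ⟦ a ∷ w ⟧ + sum (wordSplittings w) (λ (u , v) → ψ (a ∷ u) * ⟦ v ⟧)           ≈⟨ +-cong (*-identityˡ _) (sum-ψ-⟦⟧ a w) ⟩
    ⟦ a ∷ w ⟧ + - ⟦ a ∷ w ⟧                                                           ≈⟨ -‿inverseʳ _ ⟩
    0#                                                                                ∎

  ψ-inverseʳ : ∀ w → sum (wordSplittings (toList w)) (λ (u , v) → ⟦ u ⟧ * ψ v) ≈ 0#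
  ψ-inverseʳ (a ∷ w) = begin
    sum (wordSplittings (a ∷ w)) (λ (u , v) → ⟦ u ⟧ * ψ v)                            ≈⟨ sum-wordSplittings-∷ a w _ ⟩
    ⟦ [] ⟧ * ψ (a ∷ w) + sum (wordSplittings w) (λ (u , v) → ⟦ a ∷ u ⟧ * ψ v)         ≈⟨ +-cong (≈-trans (*-congʳ ι-[]) (*-identityˡ _)) (sum-⟦⟧-ψ a w) ⟩
    ψ (a ∷ w) + - ψ (a ∷ w)                                                           ≈⟨ -‿inverseʳ _ ⟩
    0#                                                                                ∎

  -- Refinement sums of sentences and their convolution with `ι`.

  refinementSum : Sentence → Carrier
  refinementSum I = sum (groupings I) λ gs → signed (ungroup gs)

  refinementSum-[] : refinementSum [] ≈ 1#
  refinementSum-[] = +-identityʳ 1#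

  refinementSum-∷ : ∀ w I → refinementSum (w ∷ I) ≈ ψ (toList w) * refinementSum I
  refinementSum-∷ (a ∷ w) I = begin
    refinementSum ((a ∷ w) ∷ I)
      ≈⟨ sum-cartesianProductWith _∷_ (blocks a w) (groupings I) _ ⟩
    sum (blocks a w) (λ g → sum (groupings I) λ gs → signed (toList g ++ ungroup gs))
      ≈⟨ sum-cong (blocks a w) (λ g → sum-cong (groupings I) λ gs → signed-++ (toList g) (ungroup gs)) ⟩
    sum (blocks a w) (λ g → sum (groupings I) λ gs → signed (toList g) * signed (ungroup gs))
      ≈⟨ sum-cong (blocks a w) (λ g → *-sum (signed (toList g)) (groupings I) _) ⟨
    sum (blocks a w) (λ g → signed (toList g) * refinementSum I)
      ≈⟨ sum-* (refinementSum I) (blocks a w) _ ⟨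
    ψ (a ∷ w) * refinementSum I
      ∎

  refinementSum-++ : ∀ I J → refinementSum (I ++ J) ≈ refinementSum I * refinementSum J
  refinementSum-++ []      J = ≈-sym (≈-trans (*-congʳ refinementSum-[]) (*-identityˡ _))
  refinementSum-++ (w ∷ I) J = begin
    refinementSum (w ∷ I ++ J)                                 ≈⟨ refinementSum-∷ w (I ++ J) ⟩
    ψ (toList w) * refinementSum (I ++ J)                      ≈⟨ *-congˡ (refinementSum-++ I J) ⟩
    ψ (toList w) * (refinementSum I * refinementSum J)         ≈⟨ *-assoc _ _ _ ⟨
    ψ (toList w) * refinementSum I * refinementSum J           ≈⟨ *-congʳ (refinementSum-∷ w I) ⟨
    refinementSum (w ∷ I) * refinementSum J                    ∎

  antipode : Sentence → Carrier
  antipode I = refinementSum (I ʳ)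

  -- Reversal moves the first word to the end, so its factor stands next to whatever multiplies from
  -- the right.
  antipode-∷ : ∀ w I → antipode (w ∷ I) ≈ antipode I * ψ (toList w)
  antipode-∷ w I = begin
    refinementSum ((w ∷ I) ʳ)                         ≡⟨ ≡.cong refinementSum (List.unfold-reverse w I) ⟩
    refinementSum (I ʳ ++ w ∷ [])                     ≈⟨ refinementSum-++ (I ʳ) (w ∷ []) ⟩
    antipode I * refinementSum (w ∷ [])               ≈⟨ *-congˡ (refinementSum-∷ w []) ⟩
    antipode I * (ψ (toList w) * refinementSum [])    ≈⟨ *-congˡ (≈-trans (*-congˡ refinementSum-[]) (*-identityʳ _)) ⟩
    antipode I * ψ (toList w)                         ∎

  antipode-tilde-∷ : ∀ u us → antipode (tilde (u ∷ us)) ≈ antipode (tilde us) * ψ u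
  antipode-tilde-∷ []      us = ≈-sym (*-identityʳ _)
  antipode-tilde-∷ (a ∷ u) us = antipode-∷ (a ∷ u) (tilde us)

  ι-tilde-∷ : ∀ u us → ι (tilde (u ∷ us)) ≈ ⟦ u ⟧ * ι (tilde us)
  ι-tilde-∷ []      us = ≈-sym (≈-trans (*-congʳ ι-[]) (*-identityˡ _))
  ι-tilde-∷ (a ∷ u) us = ι-++ ((a ∷ u) ∷ []) (tilde us)

  -- The halves of the first word give adjacent factors `ψ u * ⟦ v ⟧`, with factors independent of
  -- `u` and `v` on both sides. Summing over them first gives zero by `ψ-inverseˡ`.
  conv-inverseˡ : ∀ I → conv antipode ι I ≈ counit I
  conv-inverseˡ []      = ≈-trans (+-identityʳ _) (≈-trans (*-cong refinementSum-[] ι-[]) (*-identityʳ _))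
  conv-inverseˡ (w ∷ I) = begin
    conv antipode ι (w ∷ I)
      ≈⟨ sum-cartesianProductWith _∷_ W (allSplittings I) _ ⟩
    sum W (λ (u , v) → sum (allSplittings I) λ ps →
      antipode (tilde (u ∷ map proj₁ ps)) * ι (tilde (v ∷ map proj₂ ps)))
      ≈⟨ sum-cong W (λ (u , v) → sum-cong (allSplittings I) λ ps →
           ≈-trans (*-cong (antipode-tilde-∷ u (map proj₁ ps)) (ι-tilde-∷ v (map proj₂ ps))) (xy·zt≈x·yz·t _ _ _ _)) ⟩
    sum W (λ (u , v) → sum (allSplittings I) λ ps → S ps * (ψ u * ⟦ v ⟧ * B ps))
      ≈⟨ sum-swap W (allSplittings I) _ ⟩
    sum (allSplittings I) (λ ps → sum W λ (u , v) → S ps * (ψ u * ⟦ v ⟧ * B ps))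
      ≈⟨ sum-cong (allSplittings I) (λ ps → collapse (S ps) (B ps)) ⟩
    sum (allSplittings I) (λ _ → 0#)
      ≈⟨ sum-ε (allSplittings I) ⟩
    0#
      ∎
    where
    W : List (Word × Word)
    W = wordSplittings (toList w)
    S B : List (Word × Word) → Carrier
    S ps = antipode (tilde (map proj₁ ps))
    B ps = ι (tilde (map proj₂ ps))

    collapse : ∀ x y → sum W (λ (u , v) → x * (ψ u * ⟦ v ⟧ * y)) ≈ 0#
    collapse x y = begin
      sum W (λ (u , v) → x * (ψ u * ⟦ v ⟧ * y))    ≈⟨ *-sum x W _ ⟨
      x * sum W (λ (u , v) → ψ u * ⟦ v ⟧ * y)      ≈⟨ *-congˡ (sum-* y W _) ⟨
      x * (sum W (λ (u , v) → ψ u * ⟦ v ⟧) * y)    ≈⟨ *-congˡ (≈-trans (*-congʳ (ψ-inverseˡ w)) (zeroˡ y)) ⟩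
      x * 0#                                       ≈⟨ zeroʳ x ⟩
      0#                                           ∎

  -- Here the first word supplies the outer factors `⟦ u ⟧` and `ψ v` around the convolution at `I`.
  -- By induction that is `counit I`: zero unless `w` is the last word, when `ψ-inverseʳ` finishes.
  conv-inverseʳ : ∀ I → conv ι antipode I ≈ counit I
  conv-inverseʳ []      = ≈-trans (+-identityʳ _) (≈-trans (*-cong ι-[] refinementSum-[]) (*-identityʳ _))
  conv-inverseʳ (w ∷ I) = begin
    conv ι antipode (w ∷ I)
      ≈⟨ sum-cartesianProductWith _∷_ W (allSplittings I) _ ⟩
    sum W (λ (u , v) → sum (allSplittings I) λ ps →
      ι (tilde (u ∷ map proj₁ ps)) * antipode (tilde (v ∷ map proj₂ ps)))
      ≈⟨ sum-cong W (λ (u , v) → sum-cong (allSplittings I) λ ps →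
           ≈-trans (*-cong (ι-tilde-∷ u (map proj₁ ps)) (antipode-tilde-∷ v (map proj₂ ps))) (xy·zt≈x·yz·t _ _ _ _)) ⟩
    sum W (λ (u , v) → sum (allSplittings I) λ ps → ⟦ u ⟧ * (B ps * S ps * ψ v))
      ≈⟨ sum-cong W (λ (u , v) → pull ⟦ u ⟧ (ψ v)) ⟩
    sum W (λ (u , v) → ⟦ u ⟧ * (conv ι antipode I * ψ v))
      ≈⟨ sum-cong W (λ (u , v) → *-congˡ (*-congʳ (conv-inverseʳ I))) ⟩
    sum W (λ (u , v) → ⟦ u ⟧ * (counit I * ψ v))
      ≈⟨ collapse I ⟩
    0#
      ∎
    where
    W : List (Word × Word)
    W = wordSplittings (toList w)
    S B : List (Word × Word) → Carrier
    S ps = antipode (tilde (map proj₂ ps))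
    B ps = ι (tilde (map proj₁ ps))

    pull : ∀ x y → sum (allSplittings I) (λ ps → x * (B ps * S ps * y)) ≈ x * (conv ι antipode I * y)
    pull x y = ≈-sym (≈-trans (*-congˡ (sum-* y (allSplittings I) _)) (*-sum x (allSplittings I) _))

    collapse : ∀ I → sum W (λ (u , v) → ⟦ u ⟧ * (counit I * ψ v)) ≈ 0#
    collapse []      = ≈-trans (sum-cong W λ (u , v) → *-congˡ (*-identityˡ _)) (ψ-inverseʳ w)
    collapse (_ ∷ _) = ≈-trans (sum-cong W λ (u , v) → ≈-trans (*-congˡ (zeroˡ _)) (zeroʳ _)) (sum-ε W)

-- The concatenation ring and its link with the Hopf algebra operations.

module SentenceAlgebra {c ℓ₁ ℓ₂ a} (𝕜 : HeytingField c ℓ₁ ℓ₂) (A : Set a) (finite : Finite A) where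

  open HopfAlgebraOfSentences 𝕜 A finite
  open FreeModuleProperties 𝕜 _≟ₛ_
  private
    module Tensors = FreeModuleProperties 𝕜 (×-≡-dec _≟ₛ_ _≟ₛ_)
    module K = CommutativeRing 𝕜-commutativeRing
    module KP = RingProperties K.ring
    module V = LeftModule leftModule

  infixr 7 _▹_
  infixl 7 _·_

  -- Left multiplication by a basis sentence. Building the product from two one-variable extensions
  -- lets `linear-extend` treat each argument separately.
  _▹_ : Sentence → H → H
  I ▹ y = extend leftModule (λ J → basis (I ++ J)) y

  _·_ : H → H → H
  x · y = extend leftModule (_▹ y) x

  ▹-linear : ∀ I → Linear leftModule leftModule (I ▹_)
  ▹-linear I = extend-linear leftModule (λ J → basis (I ++ J))

  ·-linearˡ : ∀ y → Linear leftModule leftModule (_· y)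
  ·-linearˡ y = extend-linear leftModule (_▹ y)

  basis-· : ∀ I y → basis I · y ≈ᵥ I ▹ y
  basis-· I y = extend-basis leftModule (_▹ y) I

  ▹-basis : ∀ I J → I ▹ basis J ≈ᵥ basis (I ++ J)
  ▹-basis I J = extend-basis leftModule (λ J → basis (I ++ J)) J

  ▹-++ : ∀ I J y → I ▹ J ▹ y ≈ᵥ (I ++ J) ▹ y
  ▹-++ I J y = V.≈ᴹ-trans (linear-extend leftModule leftModule (▹-linear I) (λ L → basis (J ++ L)) y)
    (extend-cong-fun leftModule (λ L → V.≈ᴹ-trans (▹-basis I (J ++ L))
      (V.≈ᴹ-reflexive (≡.cong basis (≡.sym (List.++-assoc I J L))))) y)

  ▹-· : ∀ I x y → (I ▹ x) · y ≈ᵥ I ▹ (x · y)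
  ▹-· I x y = V.≈ᴹ-trans (linear-extend leftModule leftModule (·-linearˡ y) (λ J → basis (I ++ J)) x)
    (V.≈ᴹ-trans (extend-cong-fun leftModule (λ J → V.≈ᴹ-trans (basis-· (I ++ J) y) (V.≈ᴹ-sym (▹-++ I J y))) x)
      (V.≈ᴹ-sym (linear-extend leftModule leftModule (▹-linear I) (_▹ y) x)))

  ·-cong : ∀ {x x′ y y′} → x ≈ᵥ x′ → y ≈ᵥ y′ → x · y ≈ᵥ x′ · y′
  ·-cong {x} {x′} {y} {y′} x≈ y≈ = V.≈ᴹ-trans (Linear.⟦⟧-cong (·-linearˡ y) x≈)
    (extend-cong-fun leftModule (λ I → Linear.⟦⟧-cong (▹-linear I) y≈) x′)

  H-ring : Ring _ _
  H-ring = record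
    { _≈_ = _≈ᵥ_
    ; _+_ = _+ᵥ_
    ; _*_ = _·_
    ; -_  = -ᵥ_
    ; 0#  = 0ᵥ
    ; 1#  = basis []
    ; isRing = record
      { +-isAbelianGroup = V.+ᴹ-isAbelianGroup
      ; *-cong = ·-cong
      ; *-assoc = λ x y z → V.≈ᴹ-trans (linear-extend leftModule leftModule (·-linearˡ z) (_▹ y) x)
          (extend-cong-fun leftModule (λ I → ▹-· I y z) x)
      ; *-identity = (λ y → V.≈ᴹ-trans (basis-· [] y) (extend-basis-id y))
          , λ x → V.≈ᴹ-trans (extend-cong-fun leftModule (λ I → V.≈ᴹ-trans (▹-basis I [])
              (V.≈ᴹ-reflexive (≡.cong basis (List.++-identityʳ I)))) x) (extend-basis-id x)
      ; distrib = (λ x y z → V.≈ᴹ-trans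
            (extend-cong-fun leftModule (λ I → Linear.+ᴹ-homo (▹-linear I) y z) x)
            (extend-+-fun leftModule (_▹ y) (_▹ z) x))
          , λ x y z → Linear.+ᴹ-homo (·-linearˡ x) y z
      }
    }

  concatenation : Sentence × Sentence → H
  concatenation (I , J) = basis (I ++ J)

  μ-⊗ : ∀ x y → μ (x ⊗ y) ≈ᵥ x · y
  μ-⊗ []            y = V.≈ᴹ-refl
  μ-⊗ ((k , I) ∷ x) y = V.≈ᴹ-trans (Tensors.extend-+ leftModule concatenation (map _ y) (x ⊗ y)) (V.+ᴹ-cong (row y) (μ-⊗ x y))
    where
    row : ∀ y → μ (map (λ (l , J) → k K.* l , (I , J)) y) ≈ᵥ k • I ▹ y
    row []            = V.≈ᴹ-refl
    row ((l , J) ∷ y) = V.≈ᴹ-trans (V.+ᴹ-cong (V.*ₗ-assoc k l _) (row y)) (V.≈ᴹ-sym (V.*ₗ-distribˡ k (l • basis (I ++ J)) _))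

  open Ring H-ring using (setoid; -‿cong)
    renaming (refl to ≈-refl; sym to ≈-sym; trans to ≈-trans; reflexive to ≈-reflexive)
  open RingProperties H-ring using (-‿distribˡ-*)
  open ListSum V.+ᴹ-commutativeMonoid
  open Convolution H-ring A
  open SetoidReasoning setoid

  -- `S ⊗₁ T` is itself an extension from basis pairs, so its composite with `μ` is linear for
  -- arbitrary functions `S` and `T` and moves inside the extension defining `Δ`.
  convolution : ∀ S T x → μ ((S ⊗₁ T) (Δ x)) ≈ᵥ extend leftModule (conv (S ∘ basis) (T ∘ basis)) x
  convolution S T x = ≈-trans (linear-extend Tensor.leftModule leftModule h-linear Δ-basis x)
    (extend-cong-fun leftModule (λ I → ≈-trans
      (homo-sum (LeftModule.+ᴹ-commutativeMonoid Tensor.leftModule) V.+ᴹ-commutativeMonoid (Linear.+ᴹ-isMonoidHomomorphism h-linear) (allSplittings I) _)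
      (sum-cong (allSplittings I) λ ps → h-basis (tilde (map proj₁ ps)) (tilde (map proj₂ ps)))) x)
    where
    ST : Sentence × Sentence → H⊗H
    ST (I , J) = S (basis I) ⊗ T (basis J)

    h-linear : Linear Tensor.leftModule leftModule (μ ∘ (S ⊗₁ T))
    h-linear = Composition.isLeftModuleHomomorphism V.≈ᴹ-trans
      (Tensors.extend-linear Tensor.leftModule ST) (Tensors.extend-linear leftModule concatenation)

    h-basis : ∀ I J → μ ((S ⊗₁ T) (basis I ⊗ basis J)) ≈ᵥ S (basis I) · T (basis J)
    h-basis I J = begin
      -- The tensor of two basis vectors carries the coefficient `1# * 1#`, which must first be
      -- reduced to `1#`.
      μ ((S ⊗₁ T) (basis I ⊗ basis J))    ≈⟨ Linear.⟦⟧-cong h-linear (Tensors.single-cong (I , J) (K.*-identityˡ K.1#)) ⟩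
      μ ((S ⊗₁ T) (Tensor.basis (I , J))) ≈⟨ Tensors.extend-cong leftModule concatenation (Tensors.extend-basis Tensor.leftModule ST (I , J)) ⟩
      μ (S (basis I) ⊗ T (basis J))       ≈⟨ μ-⊗ (S (basis I)) (T (basis J)) ⟩
      S (basis I) · T (basis J)           ∎

  η-ε : ∀ x → η (ε x) ≈ᵥ extend leftModule (η ∘ ε-basis) x
  η-ε = linear-extend TensorUnit.leftModule leftModule
    (mkLinear TensorUnit.leftModule leftModule η V.*ₗ-congʳ (V.*ₗ-distribʳ _) (λ k l → V.*ₗ-assoc k l _)) ε-basis

  basis-++ : ∀ I J → basis (I ++ J) ≈ᵥ basis I · basis J
  basis-++ I J = ≈-sym (≈-trans (basis-· I (basis J)) (▹-basis I J))

  -- The empty sentence has no first word; its value is junk.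
  prefixₛ : A → Sentence → Sentence
  prefixₛ a []      = []
  prefixₛ a (v ∷ I) = (a ∷⁺ v) ∷ I

  prefix : A → H → H
  prefix a = extend leftModule λ I → basis (prefixₛ a I)

  prefix-linear : ∀ a → Linear leftModule leftModule (prefix a)
  prefix-linear a = extend-linear leftModule λ I → basis (prefixₛ a I)

  -- The first word of every term of the product is `v`, from the left factor; the junk value of
  -- `prefixₛ` at the empty sentence is never reached.
  prefix-basis-· : ∀ a v I y → prefix a (basis (v ∷ I) · y) ≈ᵥ basis ((a ∷⁺ v) ∷ I) · y
  prefix-basis-· a v I y = begin
    prefix a (basis (v ∷ I) · y)          ≈⟨ Linear.⟦⟧-cong (prefix-linear a) (basis-· (v ∷ I) y) ⟩
    prefix a ((v ∷ I) ▹ y)                ≈⟨ linear-extend leftModule leftModule (prefix-linear a) (λ J → basis (v ∷ I ++ J)) y ⟩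
    extend leftModule (λ J → prefix a (basis (v ∷ I ++ J))) y
      ≈⟨ extend-cong-fun leftModule (λ J → extend-basis leftModule (λ I → basis (prefixₛ a I)) (v ∷ I ++ J)) y ⟩
    ((a ∷⁺ v) ∷ I) ▹ y                    ≈⟨ basis-· ((a ∷⁺ v) ∷ I) y ⟨
    basis ((a ∷⁺ v) ∷ I) · y              ∎

  open RefinementSum H-ring A basis ≈-refl basis-++ prefix
    (λ a → Linear.+ᴹ-isGroupHomomorphism (prefix-linear a)) prefix-basis-·

  sign-basis : ∀ J → sign J • basis J ≈ᵥ signed J
  sign-basis []      = V.*ₗ-identityˡ (basis [])
  sign-basis (w ∷ J) = begin
    sign (w ∷ J) • basis (w ∷ J)               ≈⟨ single-cong (w ∷ J) (K.trans (K.*-assoc _ _ _) (KP.-1*x≈-x _)) ⟩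
    -ᵥ (sign J • basis (w ∷ J))                ≈⟨ -‿cong (V.*ₗ-congˡ (▹-basis (w ∷ []) J)) ⟨
    -ᵥ (sign J • (w ∷ []) ▹ basis J)           ≈⟨ -‿cong (Linear.*ₗ-homo (▹-linear (w ∷ [])) (sign J) (basis J)) ⟨
    -ᵥ ((w ∷ []) ▹ (sign J • basis J))         ≈⟨ -‿cong (basis-· (w ∷ []) (sign J • basis J)) ⟨
    -ᵥ (basis (w ∷ []) · (sign J • basis J))   ≈⟨ -‿distribˡ-* (basis (w ∷ [])) (sign J • basis J) ⟩
    -ᵥ basis (w ∷ []) · (sign J • basis J)     ≈⟨ ·-cong {x = -ᵥ basis (w ∷ [])} ≈-refl (sign-basis J) ⟩
    signed (w ∷ J)                             ∎

  -- `refinements I` lists the images of `groupings I` under `ungroup`, each refinement coming from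
  -- one grouping.
  ∑-refinements : ∀ I → (∑[ J ∈ refinements I ] sign J • basis J) ≈ᵥ refinementSum I
  ∑-refinements I = ≈-trans
    (≈-reflexive (sum-map (groupings I) ungroup (λ J → sign J • basis J)))
    (sum-cong (groupings I) λ gs → sign-basis (ungroup gs))

  η-ε-basis : ∀ I → η (ε-basis I) ≈ᵥ counit I
  η-ε-basis []      = V.*ₗ-identityˡ (basis [])
  η-ε-basis (_ ∷ _) = V.*ₗ-zeroˡ (basis [])

  -- Existence and uniqueness of the antipode.

  S : H → H
  S = extend leftModule antipode

  S-isAntipode : IsAntipode S
  S-isAntipode = record
    { isLinear = extend-linear leftModule antipode
    ; inverseˡ = λ x → inverse S id x λ I → ≈-trans
        (conv-cong {f = S ∘ basis} {f′ = antipode} {g = basis} S-basis (λ _ → ≈-refl) I) (conv-inverseˡ I)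
    ; inverseʳ = λ x → inverse id S x λ I → ≈-trans
        (conv-cong {f = basis} {g = S ∘ basis} {g′ = antipode} (λ _ → ≈-refl) S-basis I) (conv-inverseʳ I)
    }
    where
    S-basis : ∀ I → S (basis I) ≈ᵥ antipode I
    S-basis = extend-basis leftModule antipode

    inverse : ∀ S T x → (∀ I → conv (S ∘ basis) (T ∘ basis) I ≈ᵥ counit I) → μ ((S ⊗₁ T) (Δ x)) ≈ᵥ η (ε x)
    inverse S T x S*T≈ε = begin
      μ ((S ⊗₁ T) (Δ x))                                       ≈⟨ convolution S T x ⟩
      extend leftModule (conv (S ∘ basis) (T ∘ basis)) x       ≈⟨ extend-cong-fun leftModule (λ I → ≈-trans (S*T≈ε I) (≈-sym (η-ε-basis I))) x ⟩
      extend leftModule (η ∘ ε-basis) x                        ≈⟨ η-ε x ⟨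
      η (ε x)                                                  ∎

  -- Both `S ∘ basis` and `antipode` have convolution `counit` with `basis` on the right, and
  -- `conv-cancel` removes that factor.
  antipode-unique : ∀ S → IsAntipode S → ∀ I → S (basis I) ≈ᵥ antipode I
  antipode-unique S S-isAntipode = conv-cancel {ι = basis} ≈-refl λ I → begin
    conv (S ∘ basis) basis I                                 ≈⟨ extend-basis leftModule (conv (S ∘ basis) basis) I ⟨
    extend leftModule (conv (S ∘ basis) basis) (basis I)     ≈⟨ convolution S id (basis I) ⟨
    μ ((S ⊗₁ id) (Δ (basis I)))                              ≈⟨ IsAntipode.inverseˡ S-isAntipode (basis I) ⟩
    η (ε (basis I))                                          ≈⟨ η-ε (basis I) ⟩
    extend leftModule (η ∘ ε-basis) (basis I)                ≈⟨ extend-basis leftModule (η ∘ ε-basis) I ⟩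
    η (ε-basis I)                                            ≈⟨ η-ε-basis I ⟩
    counit I                                                 ≈⟨ conv-inverseˡ I ⟨
    conv antipode basis I                                    ∎

  antipode-formula : ∀ S → IsAntipode S → ∀ I → S (basis I) ≈ᵥ (∑[ J ∈ refinements (I ʳ) ] sign J • basis J)
  antipode-formula S S-isAntipode I = ≈-trans (antipode-unique S S-isAntipode I) (≈-sym (∑-refinements (I ʳ)))

proposition3p7 : ∀ {c ℓ₁ ℓ₂ a} (𝕜 : HeytingField c ℓ₁ ℓ₂) → CharacteristicZero 𝕜 →
    (A : Set a) (finite : Finite A) →
    let open HopfAlgebraOfSentences 𝕜 A finite in
    (∃ λ S → IsAntipode S) ×
    (∀ S → IsAntipode S → ∀ I → S (basis I) ≈ᵥ (∑[ J ∈ refinements (I ʳ) ] sign J • basis J))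
proposition3p7 𝕜 _ A finite = (S , S-isAntipode) , antipode-formula
  where open SentenceAlgebra 𝕜 A finite
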